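{- Let $\mathcal{H}$ be a set of two connected graphs with $\mathcal{H}\in\{\{K_{1,3},Z_4\},\{K_{1,3},B_{1,2}\},\{K_{1,3},N_{1,1,1}\},\{P_4,W\},\{K_{1,3}^{**},Z_1\}\}$. Then every $2$-connected $\mathcal{H}$-free graph has a dominating cycle.
   Context: All graphs are finite and simple. A cycle $C$ in a graph $G$ is dominating if every edge of $G$ has at least one end vertex on $C$. $G$ is $\mathcal{H}$-free if it contains no member of $\mathcal{H}$ as an induced subgraph. $P_n$ is the path of order $n$, $K_{1,3}$ the claw. $Z_n$ is obtained from a triangle by attaching a path with $n$ new vertices at one triangle vertex. $B_{m,n}$ is obtained from a triangle $abc$ by attaching a path of $m$ new vertices at $a$ and a path of $n$ new vertices at $b$. $N_{l,m,n}$ is obtained from a triangle $abc$ by attaching paths of $l,m,n$ new vertices at $a,b,c$ respectively. $W=K_1+3K_2$ (one vertex joined to all vertices of three disjoint edges). $K_{1,3}^{*}$ is $K_{1,3}$ with each edge subdivided once, and $K_{1,3}^{**}$ is obtained from $K_{1,3}^{*}$ by deleting one vertex of degree $1$. -}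

module Defs where

open import Data.Nat using (ℕ; _≤_)
open import Data.Fin using (Fin; zero; suc; _≟_)
open import Data.Bool using (Bool; true; false; _∧_; _∨_; not)
open import Data.Bool.Properties using (∨-comm; ∧-comm)
open import Data.List using (List; []; _∷_; _++_; [_]; length; any)
open import Data.List.Membership.Propositional using (_∈_)
open import Data.List.Relation.Unary.Unique.Propositional using (Unique)
open import Data.List.Relation.Unary.Linked using (Linked)
open import Data.Product using (Σ; _×_; _,_; ∃)
open import Data.Sum using (_⊎_)
open import Data.Unit using (⊤)
open import Data.Empty using (⊥-elim)
open import Relation.Nullary using (¬_; yes; no)
open import Relation.Nullary.Decidable using (⌊_⌋)
open import Relation.Binary.PropositionalEquality using (_≡_; _≢_; refl; cong₂)
open import Function.Definitions using (Injective)
open import Data.Fin.Literals as FinLit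
open import Data.Nat.Literals as NatLit
open import Agda.Builtin.FromNat

instance
  finNumber : ∀ {n} → Number (Fin n)
  finNumber = FinLit.number _
  natNumber : Number ℕ
  natNumber = NatLit.number

record Graph : Set where
  field
    size   : ℕ
    Adj    : Fin size → Fin size → Bool
    sym    : ∀ i j → Adj i j ≡ Adj j i
    irrefl : ∀ i → Adj i i ≡ false
open Graph public

Edge : (G : Graph) → Fin (size G) → Fin (size G) → Set
Edge G u v = Adj G u v ≡ true

InducedSub : Graph → Graph → Set
InducedSub H G =
  Σ (Fin (size H) → Fin (size G)) λ f →
    Injective _≡_ _≡_ f × (∀ i j → Adj H i j ≡ Adj G (f i) (f j))

Free : Graph → Graph → Set
Free H G = ¬ InducedSub H G

data Walk (G : Graph) (P : Fin (size G) → Set) : Fin (size G) → Fin (size G) → Set where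
  here : ∀ {x} → P x → Walk G P x x
  step : ∀ {x y z} → P x → Edge G x y → Walk G P y z → Walk G P x z

Connected : Graph → Set
Connected G = ∀ x y → Walk G (λ _ → ⊤) x y

ConnectedWithout : (G : Graph) → Fin (size G) → Set
ConnectedWithout G v = ∀ x y → x ≢ v → y ≢ v → Walk G (λ w → w ≢ v) x y

TwoConnected : Graph → Set
TwoConnected G = 3 ≤ size G × Connected G × (∀ v → ConnectedWithout G v)

record Cycle (G : Graph) : Set where
  field
    start  : Fin (size G)
    rest   : List (Fin (size G))
    long   : 2 ≤ length rest
    unique : Unique (start ∷ rest)
    linked : Linked (Edge G) (start ∷ rest ++ [ start ])

  vertices : List (Fin (size G))
  vertices = start ∷ rest
open Cycle public

Dominating : (G : Graph) → Cycle G → Set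
Dominating G C = ∀ u v → Edge G u v → u ∈ vertices C ⊎ v ∈ vertices C

HasDominatingCycle : Graph → Set
HasDominatingCycle G = ∃ λ (C : Cycle G) → Dominating G C

eqb : ∀ {n} → Fin n → Fin n → Bool
eqb i j = ⌊ i ≟ j ⌋

eqb-refl : ∀ {n} (i : Fin n) → eqb i i ≡ true
eqb-refl i with i ≟ i
... | yes _ = refl
... | no ¬p = ⊥-elim (¬p refl)

eqb-sym : ∀ {n} (i j : Fin n) → eqb i j ≡ eqb j i
eqb-sym i j with i ≟ j | j ≟ i
... | yes _ | yes _ = refl
... | no _  | no _  = refl
... | yes p | no ¬q = ⊥-elim (¬q (Relation.Binary.PropositionalEquality.sym p))
... | no ¬p | yes q = ⊥-elim (¬p (Relation.Binary.PropositionalEquality.sym q))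

inList : ∀ {n} → List (Fin n × Fin n) → Fin n → Fin n → Bool
inList [] i j = false
inList ((a , b) ∷ es) i j = ((eqb i a ∧ eqb j b) ∨ (eqb i b ∧ eqb j a)) ∨ inList es i j

inList-sym : ∀ {n} (es : List (Fin n × Fin n)) i j → inList es i j ≡ inList es j i
inList-sym [] i j = refl
inList-sym ((a , b) ∷ es) i j =
  cong₂ _∨_
    (Relation.Binary.PropositionalEquality.trans
      (∨-comm (eqb i a ∧ eqb j b) (eqb i b ∧ eqb j a))
      (cong₂ _∨_ (∧-comm (eqb i b) (eqb j a)) (∧-comm (eqb i a) (eqb j b))))
    (inList-sym es i j)

mkAdj : ∀ {n} → List (Fin n × Fin n) → Fin n → Fin n → Bool
mkAdj es i j = not (eqb i j) ∧ inList es i j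

mkGraph : (n : ℕ) → List (Fin n × Fin n) → Graph
mkGraph n es = record
  { size = n
  ; Adj = mkAdj es
  ; sym = λ i j → cong₂ (λ a b → not a ∧ b) (eqb-sym i j) (inList-sym es i j)
  ; irrefl = λ i → cong₂ (λ a b → not a ∧ b) (eqb-refl i) (refl {x = inList es i i})
  }

K13 : Graph
K13 = mkGraph 4 ((0 , 1) ∷ (0 , 2) ∷ (0 , 3) ∷ [])

P4 : Graph
P4 = mkGraph 4 ((0 , 1) ∷ (1 , 2) ∷ (2 , 3) ∷ [])

Z1 : Graph
Z1 = mkGraph 4 ((0 , 1) ∷ (1 , 2) ∷ (0 , 2) ∷ (0 , 3) ∷ [])

Z4 : Graph
Z4 = mkGraph 7 ((0 , 1) ∷ (1 , 2) ∷ (0 , 2) ∷ (0 , 3) ∷ (3 , 4) ∷ (4 , 5) ∷ (5 , 6) ∷ [])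

B12 : Graph
B12 = mkGraph 6 ((0 , 1) ∷ (1 , 2) ∷ (0 , 2) ∷ (0 , 3) ∷ (1 , 4) ∷ (4 , 5) ∷ [])

N111 : Graph
N111 = mkGraph 6 ((0 , 1) ∷ (1 , 2) ∷ (0 , 2) ∷ (0 , 3) ∷ (1 , 4) ∷ (2 , 5) ∷ [])

-- W = K_1 + 3K_2: vertex 0 joined to all of the edges 12, 34, 56.
W : Graph
W = mkGraph 7 ((1 , 2) ∷ (3 , 4) ∷ (5 , 6) ∷
               (0 , 1) ∷ (0 , 2) ∷ (0 , 3) ∷ (0 , 4) ∷ (0 , 5) ∷ (0 , 6) ∷ [])

-- K_{1,3}^{**}: K_{1,3} (centre 0, leaves 1,2,3) with edges 01, 02
-- subdivided by 4, 5 respectively (i.e. K_{1,3}^* minus one leaf).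
K13ss : Graph
K13ss = mkGraph 6 ((0 , 1) ∷ (0 , 2) ∷ (0 , 3) ∷ (1 , 4) ∷ (2 , 5) ∷ [])

data Family : Set where
  claw-Z4 claw-B12 claw-N111 P4-W K13ss-Z1 : Family

pair : Family → Graph × Graph
pair claw-Z4   = K13 , Z4
pair claw-B12  = K13 , B12
pair claw-N111 = K13 , N111
pair P4-W      = P4 , W
pair K13ss-Z1  = K13ss , Z1

PairFree : Graph × Graph → Graph → Set
PairFree (H₁ , H₂) G = Free H₁ G × Free H₂ G

{-# OPTIONS --safe #-}
module Submission where

-- Let C be a longest cycle and suppose that an edge lies outside it, in a component H of G − C.
-- Let u be a vertex of C with a neighbour in H, and let A and D be the two arcs of C from u up to
-- the next vertices of C that are attached to H.  A path from u through all vertices of A and D that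
-- finishes at the far end of one of them closes up through H to a longer cycle.
--
-- For {K₁,₃, N₁,₁,₁} and {K₁,₃, B₁,₂} the distance levels from a neighbour of u in H, taken inside
-- u ∪ A ∪ D, are cliques, and such a path is obtained by inserting the vertices of one arc into the other.
-- For {K₁,₃**, Z₁} the levels are independent and consecutive ones are completely joined; one arc
-- swallows the other in consecutive pairs and at most one vertex m is left over.  If the new cycle is
-- not longer than C, it leaves fewer outside vertices with an outside neighbour, since m has none.
-- For {P₄, W} every vertex u attached to H is joined to all of H, A and D, and W appears around u.
-- For {K₁,₃, Z₄} take a path through H with at least two inner vertices between two vertices u, v
-- of C such that first the arc A from u to v and then the path are shortest.  Then u and v have only
-- one neighbour each on A, and longer cycles or copies of Z₄ arise near u and v.

open import Defs hiding (sym)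
import Defs as D
open import Data.Bool as Bool using (Bool; true; false; T)
open import Data.Bool.Properties using (¬-not)
open import Data.Empty using (⊥; ⊥-elim)
open import Data.Fin using (Fin; zero; suc; _≟_; #_; toℕ; fromℕ<)
open import Data.Fin.Properties as Finₚ using (all?; any?)
open import Data.List as List using (List; []; _∷_; _++_; [_]; length; reverse; map; concat; allFin; filter)
import Data.List.Properties as Listₚ
open import Data.List.Membership.Propositional using (_∈_; _∉_)
open import Data.List.Membership.Propositional.Properties using (∈-++⁺ˡ; ∈-++⁺ʳ; ∈-++⁻; ∈-allFin; ∈-∃++; ∈-lookup)
open import Data.List.Relation.Unary.All as All using (All; []; _∷_)
import Data.List.Relation.Unary.All.Properties as Allₚ
open import Data.List.Relation.Unary.AllPairs using ([]; _∷_)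
open import Data.List.Relation.Unary.Any as Any using (Any; here; there)
open import Data.List.Relation.Unary.Linked as Linked using (Linked; [-]; _∷_)
open import Data.List.Relation.Unary.Unique.Propositional using (Unique)
import Data.List.Relation.Unary.Unique.Propositional.Properties as Uniqueₚ
import Data.List.Relation.Unary.Unique.DecPropositional as UniqueDec
open import Data.List.Relation.Binary.Permutation.Propositional as Perm
  using (_↭_; prep; swap; ↭-refl; ↭-sym; ↭-trans; ↭-reflexive; ↭⇒↭ₛ)
import Data.List.Relation.Binary.Permutation.Propositional.Properties as Permₚ
import Data.List.Relation.Binary.Permutation.Setoid.Properties as PermSₚ
open import Data.Maybe as Maybe using (Maybe; just; nothing; is-just; to-witness-T; _>>=_)
open import Data.Nat as ℕ using (ℕ; zero; suc; _+_; _≤_; _<_; z≤n; s≤s)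
import Data.Nat.Properties as ℕₚ
open import Data.Nat.Induction using (<-wellFounded)
open import Data.Product using (Σ; ∃; _×_; _,_; proj₁; proj₂)
open import Data.Sum using (_⊎_; inj₁; inj₂; [_,_]′)
open import Data.Unit using (⊤)
open import Data.Vec as Vec using (Vec; lookup; []; _∷_)
open import Function using (_∘_; id)
open import Function.Definitions using (Injective)
open import Induction.WellFounded using (Acc; acc)
open import Relation.Nullary using (¬_; Dec; yes; no; contradiction)
open import Relation.Nullary.Decidable
  using (True; toWitness; _×-dec_; _⊎-dec_; _→-dec_; ¬?; map′; decidable-stable)
open import Relation.Binary.Definitions using (tri<; tri≈; tri>)
open import Relation.Binary.PropositionalEquality
  using (_≡_; _≢_; refl; sym; trans; cong; subst; setoid; module ≡-Reasoning)
import Algebra.Solver.CommutativeMonoid as CommutativeMonoidSolver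

-- Whether a graph has a dominating cycle is decided by a finite search, so it suffices to refute
-- its absence. Most arguments below end in `⊥`, where case distinctions, the choice of an extremal
-- cycle and the decidability of membership in H come for free. Most longer cycles are displayed in
-- one way: C and some vertices of H are cut into segments, and the new cycle is a word in these
-- segments, each read forwards or backwards. That the word repeats no segment is checked by
-- evaluation; only the adjacency of consecutive ends has to be supplied. Maximal length of C is
-- enough for four of the five pairs. For {K₁,₃**, Z₁} the new cycle may just trade m for one vertex
-- of H, so ties in length must be broken too. For {K₁,₃, Z₄} the minimum is taken over all cycles
-- on the vertex set of C: a further neighbour of u or v on A would allow a rearrangement with a
-- shorter A. Two inner vertices on the outside path force two inner vertices on A, and these supply
-- the triangle of Z₄ in the last case.

case-⊥ : {P : Set} → (P → ⊥) → (¬ P → ⊥) → ⊥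
case-⊥ f g = g f

-- Tables of symmetric relations

Row : (n : ℕ) → (Fin n → Set) → Set
Row zero          P = ⊤
Row (suc zero)    P = P zero
Row (suc (suc n)) P = P zero × Row (suc n) (P ∘ suc)

row : ∀ n {P : Fin n → Set} → Row n P → ∀ i → P i
row (suc zero)    r       zero    = r
row (suc (suc n)) (p , _) zero    = p
row (suc (suc n)) (_ , r) (suc i) = row (suc n) r i

-- For a symmetric relation with known diagonal the entries above the diagonal suffice. Small sizes
-- have clauses of their own so that a table is a plain nested tuple without a trailing unit.
Upper : (n : ℕ) → (Fin n → Fin n → Set) → Set
Upper zero          R = ⊤
Upper (suc zero)    R = ⊤
Upper (suc (suc zero)) R = R zero (suc zero)
Upper (suc n@(suc (suc _))) R = Row n (R zero ∘ suc) × Upper n (λ i j → R (suc i) (suc j))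

upper : ∀ n {R : Fin n → Fin n → Set} → (∀ i → R i i) → (∀ {i j} → R i j → R j i) →
        Upper n R → ∀ i j → R i j
upper _                         δ σ u       zero    zero    = δ zero
upper (suc (suc zero))          δ σ r       zero    (suc zero) = r
upper (suc (suc zero))          δ σ r       (suc zero) zero = σ r
upper (suc (suc zero))          δ σ r       (suc zero) (suc zero) = δ (suc zero)
upper (suc n@(suc (suc _))) {R} δ σ (r , _) zero    (suc j) = row n {R zero ∘ suc} r j
upper (suc n@(suc (suc _))) {R} δ σ (r , _) (suc i) zero    = σ (row n {R zero ∘ suc} r i)
upper (suc n@(suc (suc _))) {R} δ σ (_ , u) (suc i) (suc j) = upper n (δ ∘ suc) σ u i j

-- Induced subgraphs

-- Equal images of two vertices force equal rows of the adjacency matrix, so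
-- without false twins injectivity of an induced embedding is automatic.
Twinless : Graph → Set
Twinless H = ∀ i j → (∀ k → Adj H i k ≡ Adj H j k) → i ≡ j

twinless? : ∀ H → Dec (Twinless H)
twinless? H = all? λ i → all? λ j → all? (λ k → Adj H i k Bool.≟ Adj H j k) →-dec (i ≟ j)

module Basics (G : Graph) where

  V : Set
  V = Fin (size G)

  infix 4 _~_ _≁_
  _~_ _≁_ : V → V → Set
  a ~ b = Edge G a b
  a ≁ b = ¬ (a ~ b)

  _~?_ : ∀ a b → Dec (a ~ b)
  a ~? b = Adj G a b Bool.≟ true

  ~-sym : ∀ {a b} → a ~ b → b ~ a
  ~-sym {a} {b} e = trans (D.sym G b a) e

  ≁-sym : ∀ {a b} → a ≁ b → b ≁ a
  ≁-sym n = n ∘ ~-sym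

  ≁-refl : ∀ {a} → a ≁ a
  ≁-refl {a} e with trans (sym e) (irrefl G a)
  ... | ()

  ~⇒≢ : ∀ {a b} → a ~ b → a ≢ b
  ~⇒≢ e refl = ≁-refl e

  Matches : Bool → V → V → Set
  Matches true  a b = a ~ b
  Matches false a b = a ≁ b

  matches : ∀ t {a b} → Matches t a b → t ≡ Adj G a b
  matches true  e = sym e
  matches false n = sym (¬-not n)

  Pattern : (H : Graph) → Vec V (size H) → Set
  Pattern H vs = Upper (size H) λ i j → Matches (Adj H i j) (lookup vs i) (lookup vs j)

  pattern-adj : ∀ H vs → Pattern H vs → ∀ i j → Adj H i j ≡ Adj G (lookup vs i) (lookup vs j)
  pattern-adj H vs p i j = matches (Adj H i j) (upper (size H) δ σ p i j)
    where
    δ : ∀ i → Matches (Adj H i i) (lookup vs i) (lookup vs i)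
    δ i rewrite irrefl H i = ≁-refl
    σ : ∀ {i j} → Matches (Adj H i j) (lookup vs i) (lookup vs j) →
        Matches (Adj H j i) (lookup vs j) (lookup vs i)
    σ {i} {j} m with Adj H i j | Adj H j i | D.sym H i j
    ... | true  | .true  | refl = ~-sym m
    ... | false | .false | refl = ≁-sym m

  induced : ∀ H {tw : True (twinless? H)} vs → Pattern H vs → InducedSub H G
  induced H {tw} vs p = lookup vs , inj , pattern-adj H vs p
    where
    inj : ∀ {i j} → lookup vs i ≡ lookup vs j → i ≡ j
    inj {i} {j} eq = toWitness tw i j λ k →
      trans (pattern-adj H vs p i k)
        (trans (cong (λ v → Adj G v (lookup vs k)) eq) (sym (pattern-adj H vs p j k)))

  -- The leaves of a claw are false twins, so their distinctness does not follow from the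
  -- adjacencies and enters as a hypothesis.
  claw : Free K13 G → ∀ {c a b d} → a ≢ b → a ≢ d → b ≢ d → c ~ a → c ~ b → c ~ d →
         a ≁ b → a ≁ d → b ≁ d → ⊥
  claw free {c} {a} {b} {d} a≢b a≢d b≢d ca cb cd ab ad bd =
    free (lookup vs , inj _ _ , pattern-adj K13 vs ((ca , cb , cd) , (ab , ad) , bd))
    where
    vs = c ∷ a ∷ b ∷ d ∷ []
    no-eq : ∀ {x y} {i j : Fin 4} → x ≢ y → x ≡ y → i ≡ j
    no-eq x≢y e = contradiction e x≢y
    inj : ∀ i j → lookup vs i ≡ lookup vs j → i ≡ j
    inj = upper 4 (λ _ _ → refl) (λ f e → sym (f (sym e)))
      ((no-eq (~⇒≢ ca) , no-eq (~⇒≢ cb) , no-eq (~⇒≢ cd)) , (no-eq a≢b , no-eq a≢d) , no-eq b≢d)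

-- Paths and closed tours

Unique-resp-↭ : ∀ {A : Set} {xs ys : List A} → xs ↭ ys → Unique xs → Unique ys
Unique-resp-↭ {A} p = PermSₚ.Unique-resp-↭ (setoid A) (↭⇒↭ₛ p)

Unique-++⁻ˡ : ∀ {A : Set} (xs : List A) {ys} → Unique (xs ++ ys) → Unique xs
Unique-++⁻ˡ []       _        = []
Unique-++⁻ˡ (x ∷ xs) (p ∷ us) = Allₚ.++⁻ˡ xs p ∷ Unique-++⁻ˡ xs us

Unique-++⁻ʳ : ∀ {A : Set} (xs : List A) {ys} → Unique (xs ++ ys) → Unique ys
Unique-++⁻ʳ []       us       = us
Unique-++⁻ʳ (x ∷ xs) (_ ∷ us) = Unique-++⁻ʳ xs us

Unique-disjoint : ∀ {A : Set} (xs : List A) {ys a b} → Unique (xs ++ ys) → a ∈ xs → b ∈ ys → a ≢ b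
Unique-disjoint (x ∷ xs) (p ∷ us) (here refl) b∈ys = All.lookup (Allₚ.++⁻ʳ xs p) b∈ys
Unique-disjoint (x ∷ xs) (p ∷ us) (there a∈)  b∈ys = Unique-disjoint xs us a∈ b∈ys

concat⁺-↭ : ∀ {A : Set} {xss yss : List (List A)} → xss ↭ yss → concat xss ↭ concat yss
concat⁺-↭ Perm.refl          = ↭-refl
concat⁺-↭ (prep xs p)        = Permₚ.++⁺ˡ xs (concat⁺-↭ p)
concat⁺-↭ (swap xs ys p)     = ↭-trans (Permₚ.shifts xs ys) (Permₚ.++⁺ˡ ys (Permₚ.++⁺ˡ xs (concat⁺-↭ p)))
concat⁺-↭ (Perm.trans p q)   = ↭-trans (concat⁺-↭ p) (concat⁺-↭ q)

extract : ∀ {m} (i : Fin m) (js : List (Fin m)) → Maybe (∃ λ ks → js ↭ i ∷ ks)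
extract i []       = nothing
extract i (j ∷ js) with i ≟ j
... | yes refl = just (js , ↭-refl)
... | no _     = Maybe.map (λ (ks , p) → j ∷ ks , ↭-trans (prep j p) (swap j i ↭-refl)) (extract i js)

-- On the concrete words used below this evaluates to `just`, and the implicit arguments `ok` are
-- then solved by evaluation.
permutation? : ∀ {m} (is js : List (Fin m)) → Maybe (is ↭ js)
permutation? []       []      = just ↭-refl
permutation? []       (_ ∷ _) = nothing
permutation? (i ∷ is) js      =
  extract i js >>= λ (ks , p) → Maybe.map (λ q → ↭-trans (prep i q) (↭-sym p)) (permutation? is ks)

data Oriented (m : ℕ) : Set where
  forward backward : Fin m → Oriented m

index : ∀ {m} → Oriented m → Fin m
index (forward i)  = i
index (backward i) = i

fw bw : ∀ {m} i {i<m : True (i ℕ.<? m)} → Oriented m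
fw i {i<m} = forward (#_ i {m<n = i<m})
bw i {i<m} = backward (#_ i {m<n = i<m})

module Paths (G : Graph) where
  open Basics G public

  infixr 5 _∷_
  data Path : V → V → List V → Set where
    end : ∀ {a} → Path a a [ a ]
    _∷_ : ∀ {a b c xs} → a ~ b → Path b c xs → Path a c (a ∷ xs)

  append : ∀ {a b c d xs ys} → Path a b xs → b ~ c → Path c d ys → Path a d (xs ++ ys)
  append end     e q = e ∷ q
  append (f ∷ p) e q = f ∷ append p e q

  reversed : ∀ {a b xs} → Path a b xs → Path b a (reverse xs)
  reversed end = end
  reversed {xs = x ∷ xs} (e ∷ p) =
    subst (Path _ _) (sym (Listₚ.unfold-reverse x xs)) (append (reversed p) (~-sym e) end)

  head∈ : ∀ {a b xs} → Path a b xs → a ∈ xs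
  head∈ end     = here refl
  head∈ (_ ∷ _) = here refl

  last∈ : ∀ {a b xs} → Path a b xs → b ∈ xs
  last∈ end     = here refl
  last∈ (_ ∷ p) = there (last∈ p)

  path-head : ∀ {a b x xs} → Path a b (x ∷ xs) → a ≡ x
  path-head end     = refl
  path-head (_ ∷ _) = refl

  split : ∀ {a b} x xs {y ys} → Path a b (x ∷ xs ++ y ∷ ys) →
          ∃ λ c → Path a c (x ∷ xs) × c ~ y × Path y b (y ∷ ys)
  split x []       (e ∷ p) with path-head p
  ... | refl = x , end , e , p
  split x (z ∷ xs) (e ∷ p) with split z xs p
  ... | c , q , f , r = c , e ∷ q , f , r

  record Seg : Set where
    constructor seg
    field
      {hd lst} : V
      {verts}  : List V
      path     : Path hd lst verts
  open Seg public

  single : V → Seg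
  single v = seg (end {v})

  flip : Seg → Seg
  flip s = seg (reversed (path s))

  flat : ∀ {m} → Vec Seg m → List V
  flat []      = []
  flat (s ∷ ρ) = verts s ++ flat ρ

  module _ {m : ℕ} (ρ : Vec Seg m) where

    at : Oriented m → Seg
    at (forward i) = lookup ρ i
    at (backward i) = flip (lookup ρ i)

    -- `f` remembers the first segment, to which the last one must return.
    Closed : Oriented m → Oriented m → List (Oriented m) → Set
    Closed f s []      = lst (at s) ~ hd (at f)
    Closed f s (t ∷ r) = lst (at s) ~ hd (at t) × Closed f t r

    trace : Oriented m → List (Oriented m) → List V
    trace s []      = verts (at s)
    trace s (t ∷ r) = verts (at s) ++ trace t r

    follow : ∀ f s r → Closed f s r → ∃ λ e → Path (hd (at s)) e (trace s r) × e ~ hd (at f)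
    follow f s []      c       = _ , path (at s) , c
    follow f s (t ∷ r) (e , c) with follow f t r c
    ... | z , p , e′ = z , append (path (at s)) e p , e′

    pick : List (Fin m) → List V
    pick is = concat (map (verts ∘ lookup ρ) is)

    at-↭ : ∀ s → verts (at s) ↭ verts (lookup ρ (index s))
    at-↭ (forward i) = ↭-refl
    at-↭ (backward i) = Permₚ.↭-reverse _

    trace-↭ : ∀ s r ds → trace s r ++ pick ds ↭ pick (index s ∷ map index r ++ ds)
    trace-↭ s []      ds = Permₚ.++⁺ʳ (pick ds) (at-↭ s)
    trace-↭ s (t ∷ r) ds = ↭-trans (↭-reflexive (Listₚ.++-assoc (verts (at s)) (trace t r) (pick ds)))
                                   (Permₚ.++⁺ (at-↭ s) (trace-↭ t r ds))

  flat-pick : ∀ {m} (ρ : Vec Seg m) → flat ρ ≡ pick ρ (allFin m)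
  flat-pick []      = refl
  flat-pick (s ∷ ρ) = cong (verts s ++_) (trans (flat-pick ρ) (cong concat
    (trans (Listₚ.map-tabulate id (verts ∘ lookup ρ)) (sym (Listₚ.map-tabulate suc (verts ∘ lookup (s ∷ ρ)))))))

  -- An edge run back and forth also counts as a closed path here; the bounds in use are at least 3,
  -- so this is harmless.
  NoLonger : ℕ → Set
  NoLonger N = ∀ {a b xs} → Path a b xs → b ~ a → Unique xs → length xs ≤ N

  retrace : ∀ {m} (ρ : Vec Seg m) s r ds
            {ok : T (is-just (permutation? (index s ∷ map index r ++ ds) (allFin m)))} →
            trace ρ s r ++ pick ρ ds ↭ flat ρ
  retrace ρ s r ds {ok} = ↭-trans (trace-↭ ρ s r ds) (↭-trans
    (concat⁺-↭ (Permₚ.map⁺ _ (to-witness-T (permutation? _ _) ok))) (↭-reflexive (sym (flat-pick ρ))))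

  module Exchange {N : ℕ} (max : NoLonger N) {m : ℕ} (ρ : Vec Seg m) (unique : Unique (flat ρ)) where

    -- ds lists the segments that the tour leaves out.
    tour : ∀ s r ds {ok : T (is-just (permutation? (index s ∷ map index r ++ ds) (allFin m)))} →
           Closed ρ s s r → length (flat ρ) ≤ N + length (pick ρ ds)
    tour s r ds {ok} c with follow ρ s s r c
    ... | e , p , close = begin
      length (flat ρ)                        ≡⟨ Permₚ.↭-length perm ⟨
      length (trace ρ s r ++ pick ρ ds)      ≡⟨ Listₚ.length-++ (trace ρ s r) ⟩
      length (trace ρ s r) + length (pick ρ ds)
        ≤⟨ ℕₚ.+-monoˡ-≤ _ (max p close (Unique-++⁻ˡ (trace ρ s r) (Unique-resp-↭ (↭-sym perm) unique))) ⟩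
      N + length (pick ρ ds)                 ∎
      where
      open ℕₚ.≤-Reasoning
      perm = retrace ρ s r ds {ok}

    full-tour : N < length (flat ρ) → ∀ s r {ok : T (is-just (permutation? (index s ∷ map index r ++ []) (allFin m)))} →
                Closed ρ s s r → ⊥
    full-tour N<L s r {ok} c = ℕₚ.<⇒≱ N<L (ℕₚ.≤-trans (tour s r [] {ok} c) (ℕₚ.≤-reflexive (ℕₚ.+-identityʳ N)))

-- Extremal cycles

count-≤ : ∀ {A : Set} {P Q : A → Set} (P? : ∀ x → Dec (P x)) (Q? : ∀ x → Dec (Q x)) →
          (∀ {x} → Q x → P x) → ∀ xs → length (filter Q? xs) ≤ length (filter P? xs)
count-≤ P? Q? Q⊆P [] = z≤n
count-≤ P? Q? Q⊆P (x ∷ xs) with Q? x | P? x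
... | yes q | yes p = s≤s (count-≤ P? Q? Q⊆P xs)
... | yes q | no ¬p = contradiction (Q⊆P q) ¬p
... | no ¬q | yes p = ℕₚ.m≤n⇒m≤1+n (count-≤ P? Q? Q⊆P xs)
... | no ¬q | no ¬p = count-≤ P? Q? Q⊆P xs

count-< : ∀ {A : Set} {P Q : A → Set} (P? : ∀ x → Dec (P x)) (Q? : ∀ x → Dec (Q x)) →
          (∀ {x} → Q x → P x) → ∀ {z xs} → z ∈ xs → P z → ¬ Q z →
          length (filter Q? xs) < length (filter P? xs)
count-< P? Q? Q⊆P {xs = x ∷ xs} (here refl) pz ¬qz with Q? x | P? x
... | yes q | _     = contradiction q ¬qz
... | no _  | yes p = s≤s (count-≤ P? Q? Q⊆P xs)
... | no _  | no ¬p = contradiction pz ¬p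
count-< P? Q? Q⊆P {xs = x ∷ xs} (there z∈) pz ¬qz with Q? x | P? x
... | yes q | yes p = s≤s (count-< P? Q? Q⊆P z∈ pz ¬qz)
... | yes q | no ¬p = contradiction (Q⊆P q) ¬p
... | no ¬q | yes p = ℕₚ.m≤n⇒m≤1+n (count-< P? Q? Q⊆P z∈ pz ¬qz)
... | no ¬q | no ¬p = count-< P? Q? Q⊆P z∈ pz ¬qz

Unique-lookup : ∀ {A : Set} {xs : List A} → Unique xs → Injective _≡_ _≡_ (List.lookup xs)
Unique-lookup (_ ∷ _)  {zero}  {zero}  _ = refl
Unique-lookup {xs = x ∷ xs} (p ∷ _)  {zero}  {suc j} e = contradiction e (All.lookup p (∈-lookup {xs = xs} j))
Unique-lookup {xs = x ∷ xs} u@(_ ∷ _)  {suc i} {zero}  e = sym (Unique-lookup u {zero} {suc i} (sym e))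
Unique-lookup (_ ∷ us) {suc i} {suc j} e = cong suc (Unique-lookup us e)

Unique-length : ∀ {n} {xs : List (Fin n)} → Unique xs → length xs ≤ n
Unique-length us = Finₚ.injective⇒≤ (Unique-lookup us)

find-list? : ∀ {n} k {Q : List (Fin n) → Set} → (∀ xs → Dec (Q xs)) → Dec (∃ λ xs → length xs ≡ k × Q xs)
find-list? zero    Q? = map′ (λ q → [] , refl , q) (λ { ([] , _ , q) → q }) (Q? [])
find-list? (suc k) Q? = map′ (λ (x , xs , e , q) → x ∷ xs , cong suc e , q)
                             (λ { (x ∷ xs , e , q) → x , xs , ℕₚ.suc-injective e , q })
                             (any? λ x → find-list? k λ xs → Q? (x ∷ xs))

-- Under a double negation finitely many instances can be decided one after another. It is applied
-- to `H`, which is defined by the existence of walks.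
decide-all : ∀ n {P : Fin n → Set} → ((∀ i → Dec (P i)) → ⊥) → ⊥
decide-all zero    f = f λ ()
decide-all (suc n) f = decide-all n λ d → case-⊥
  (λ p → f λ { zero → yes p ; (suc i) → d i })
  (λ ¬p → f λ { zero → no ¬p ; (suc i) → d i })

module Cycles (G : Graph) where
  open Paths G public

  _∈?_ : (v : V) (xs : List V) → Dec (v ∈ xs)
  v ∈? xs = Any.any? (v ≟_) xs

  suffix : ∀ {a b xs x} → x ∈ xs → Path a b xs → ∃ λ zs → ∃ λ ys → Path x b ys × xs ≡ zs ++ ys
  suffix (here refl) p with path-head p
  ... | refl = [] , _ , p , refl
  suffix (there x∈) (_∷_ {a} e p) with suffix x∈ p
  ... | zs , ys , q , refl = a ∷ zs , ys , q , refl

  simple : ∀ {P a b} → Walk G P a b → ∃ λ xs → Path a b xs × Unique xs × All P xs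
  simple (here p) = _ , end , [] ∷ [] , p ∷ []
  simple (step {x} p e w) with simple w
  ... | xs , q , us , ps with x ∈? xs
  ...   | no x∉  = x ∷ xs , e ∷ q , Allₚ.¬Any⇒All¬ xs x∉ ∷ us , p ∷ ps
  ...   | yes x∈ with suffix x∈ q
  ...     | zs , ys , r , refl = ys , r , Unique-++⁻ʳ zs us , Allₚ.++⁻ʳ zs ps

  walk-start : ∀ {P a b} → Walk G P a b → P a
  walk-start (here p)     = p
  walk-start (step p _ _) = p

  walk-snoc : ∀ {P a b c} → Walk G P a b → b ~ c → P c → Walk G P a c
  walk-snoc (here p)     e pc = step p e (here pc)
  walk-snoc (step p f w) e pc = step p f (walk-snoc w e pc)

  walk-append : ∀ {P a b c} → Walk G P a b → Walk G P b c → Walk G P a c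
  walk-append (here _)     v = v
  walk-append (step p e w) v = step p e (walk-append w v)

  walk-reverse : ∀ {P a b} → Walk G P a b → Walk G P b a
  walk-reverse (here p)     = here p
  walk-reverse (step p e w) = walk-snoc (walk-reverse w) (~-sym e) p

  Closing : List V → Set
  Closing xs = ∃ λ a → ∃ λ b → Path a b xs × b ~ a × Unique xs

  path⇒linked : ∀ {a b z xs} → Path a b xs → b ~ z → Linked (Edge G) (xs ++ [ z ])
  path⇒linked end               f = f ∷ [-]
  path⇒linked (e ∷ end)         f = e ∷ f ∷ [-]
  path⇒linked (e ∷ p@(_ ∷ _))   f = e ∷ path⇒linked p f

  cycle : ∀ {xs} → Closing xs → 3 ≤ length xs → Cycle G
  cycle {x ∷ xs} (a , b , p , f , us) (s≤s l) with path-head p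
  ... | refl = record { start = x ; rest = xs ; long = l ; unique = us ; linked = path⇒linked p f }

  cycle-vertices : ∀ {xs} (c : Closing xs) (l : 3 ≤ length xs) → vertices (cycle c l) ≡ xs
  cycle-vertices {x ∷ xs} (a , b , p , f , us) (s≤s l) with path-head p
  ... | refl = refl

  IsCycle : List V → Set
  IsCycle []       = ⊥
  IsCycle (x ∷ xs) = 2 ≤ length xs × Unique (x ∷ xs) × Linked (Edge G) (x ∷ xs ++ [ x ])

  Dominates : List V → Set
  Dominates xs = ∀ u v → u ~ v → u ∈ xs ⊎ v ∈ xs

  isCycle? : ∀ xs → Dec (IsCycle xs × Dominates xs)
  isCycle? []       = no λ ()
  isCycle? (x ∷ xs) =
    ((2 ℕ.≤? length xs) ×-dec UniqueDec.unique? _≟_ (x ∷ xs) ×-dec Linked.linked? _~?_ (x ∷ xs ++ [ x ]))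
    ×-dec Finₚ.all? λ u → Finₚ.all? λ v → (u ~? v) →-dec ((u ∈? (x ∷ xs)) ⊎-dec (v ∈? (x ∷ xs)))

  -- A cycle repeats no vertex, so lists of length at most `size G` exhaust the candidates.
  hasDominatingCycle? : Dec (HasDominatingCycle G)
  hasDominatingCycle? = map′ found bounded (any? λ k → find-list? (toℕ k) isCycle?)
    where
    found : (∃ λ (k : Fin (suc (size G))) → ∃ λ xs → length xs ≡ toℕ k × IsCycle xs × Dominates xs) →
            HasDominatingCycle G
    found (_ , x ∷ xs , _ , (l , us , k) , d) =
      record { start = x ; rest = xs ; long = l ; unique = us ; linked = k } , d
    bounded : HasDominatingCycle G →
              ∃ λ (k : Fin (suc (size G))) → ∃ λ xs → length xs ≡ toℕ k × IsCycle xs × Dominates xs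
    bounded (C , d) = fromℕ< (s≤s (Unique-length (unique C))) , vertices C ,
      sym (Finₚ.toℕ-fromℕ< (s≤s (Unique-length (unique C)))) , (long C , unique C , linked C) , d

  Exposed : List V → V → Set
  Exposed xs z = z ∉ xs × ∃ λ t → t ∉ xs × z ~ t

  exposed? : ∀ xs z → Dec (Exposed xs z)
  exposed? xs z = ¬? (z ∈? xs) ×-dec any? λ t → ¬? (t ∈? xs) ×-dec (z ~? t)

  exposure : List V → ℕ
  exposure xs = length (filter (exposed? xs) (allFin (size G)))

  -- An undominating cycle that cannot be improved: neither in length nor, at
  -- equal length, in the number of outside vertices with an outside neighbour.
  Extremal : Set
  Extremal = ∃ λ xs → Closing xs × 3 ≤ length xs × NoLonger (length xs) ×
    (∀ {ys} → Closing ys → length ys ≡ length xs → exposure ys < exposure xs → ⊥) ×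
    ∃ λ x → ∃ λ y → x ~ y × x ∉ xs × y ∉ xs

  module _ (undominated : ¬ HasDominatingCycle G) (¬ext : ¬ Extremal) where

    -- At maximal length an undominated edge makes the cycle `Extremal`, unless an equally long
    -- cycle has smaller exposure; the recursion refutes that as well.
    improve-exposure : ∀ {L} → 3 ≤ L → NoLonger L →
      ∀ {xs} → Closing xs → length xs ≡ L → Acc _<_ (exposure xs) → ⊥
    improve-exposure l max {xs} c refl (acc better) =
      case-⊥ {Dominates xs}
        (λ d → undominated (cycle c l , subst Dominates (sym (cycle-vertices c l)) d))
        (λ ¬d → ¬d λ u v e → decidable-stable ((u ∈? xs) ⊎-dec (v ∈? xs)) λ ¬∈ →
          ¬ext (xs , c , l , max , (λ c′ eq lt → improve-exposure l max c′ eq (better lt)) ,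
                u , v , e , ¬∈ ∘ inj₁ , ¬∈ ∘ inj₂))

    -- `NoLonger` is not tested but proved: every longer cycle is refuted by the recursion, whose
    -- measure is the number of vertices off the cycle.
    improve-length : ∀ {xs} → Closing xs → 3 ≤ length xs → ∀ {k} → k ≡ size G ℕ.∸ length xs → Acc _<_ k → ⊥
    improve-length {xs} c l k≡ (acc longer) = improve-exposure l
      (λ p f us → ℕₚ.≮⇒≥ λ len → improve-length (_ , _ , p , f , us) (ℕₚ.≤-trans l (ℕₚ.<⇒≤ len)) refl
        (longer (subst (_ <_) (sym k≡) (ℕₚ.∸-monoʳ-< len (Unique-length us)))))
      c refl (<-wellFounded _)

  -- Connectivity gives a neighbour `p`; a walk from `v` to a third vertex that avoids `p` starts
  -- with another neighbour.
  neighbours : TwoConnected G → ∀ v → ∃ λ p → ∃ λ q → p ≢ q × v ~ p × v ~ q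
  neighbours (3≤n , conn , conn-) v with two-others 3≤n v
    where
    two-others : ∀ {n} → 3 ≤ n → (v : Fin n) → ∃ λ w → w ≢ v
    two-others (s≤s (s≤s _)) zero    = suc zero , λ ()
    two-others (s≤s (s≤s _)) (suc v) = zero , λ ()
  ... | w , w≢v with conn v w
  ...   | here _ = contradiction refl w≢v
  ...   | step {y = p} _ v~p _ with third 3≤n v p
    where
    third : ∀ {n} → 3 ≤ n → (v p : Fin n) → ∃ λ z → z ≢ v × z ≢ p
    third (s≤s (s≤s (s≤s _))) zero          zero          = suc zero , (λ ()) , λ ()
    third (s≤s (s≤s (s≤s _))) zero          (suc zero)    = suc (suc zero) , (λ ()) , λ ()
    third (s≤s (s≤s (s≤s _))) zero          (suc (suc p)) = suc zero , (λ ()) , λ ()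
    third (s≤s (s≤s (s≤s _))) (suc zero)    zero          = suc (suc zero) , (λ ()) , λ ()
    third (s≤s (s≤s (s≤s _))) (suc (suc v)) zero          = suc zero , (λ ()) , λ ()
    third (s≤s (s≤s (s≤s _))) (suc v)       (suc p)       = zero , (λ ()) , λ ()
  ...     | z , z≢v , z≢p with conn- p v z (~⇒≢ v~p) z≢p
  ...       | here _ = contradiction refl z≢v
  ...       | step _ v~q w = p , _ , (λ { refl → walk-start w refl }) , v~p , v~q

  some-cycle : TwoConnected G → ∃ λ xs → Closing xs × 3 ≤ length xs
  some-cycle tc@(s≤s (s≤s (s≤s _)) , _ , conn-) with neighbours tc zero
  ... | p , q , p≢q , v~p , v~q with simple (conn- zero p q (~⇒≢ v~p ∘ sym) (~⇒≢ v~q ∘ sym))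
  ...   | xs , path , us , ps =
    zero ∷ xs , (_ , _ , v~p ∷ path , ~-sym v~q , All.map (_∘ sym) ps ∷ us) , s≤s (two path)
    where
    two : ∀ {ys} → Path p q ys → 2 ≤ length ys
    two end               = contradiction refl p≢q
    two (_ ∷ end)         = s≤s (s≤s z≤n)
    two (_ ∷ _ ∷ _)       = s≤s (s≤s z≤n)

  by-extremality : TwoConnected G → ¬ Extremal → HasDominatingCycle G
  by-extremality tc ¬ext = decidable-stable hasDominatingCycle? λ undominated →
    let xs , c , l = some-cycle tc
    in improve-length undominated ¬ext c l refl (<-wellFounded _)

-- Components outside a cycle

module Shuffle (A : Set) where
  open CommutativeMonoidSolver (Permₚ.++-commutativeMonoid {A = A}) public

module Components (G : Graph) where
  open Cycles G public
  open Shuffle V public using (solve; _⊕_; _⊜_)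

  -- A path from `a` to `u` with `u` left off the list. In `nil` the tip is `u` itself, so an empty
  -- arc is covered too.
  data Arm (u : V) : V → List V → Set where
    nil : Arm u u []
    _∷_ : ∀ {a b bs} → a ~ b → Arm u b bs → Arm u a (a ∷ bs)

  arm-path : ∀ {u a as} → Arm u a as → Path a u (as ++ [ u ])
  arm-path nil     = end
  arm-path (e ∷ r) = e ∷ arm-path r

  -- The arm grows at its tip while the path is consumed up to the first vertex with `P`; hence arms
  -- list their vertices towards `u`.
  scan : ∀ {P : V → Set} (P? : ∀ z → Dec (P z)) {u a as b e bs} →
         Arm u a as → All (¬_ ∘ P) as → a ~ b → Path b e bs → Any P bs →
         ∃ λ v → ∃ λ a′ → ∃ λ as′ → ∃ λ rs →
         P v × Arm u a′ as′ × All (¬_ ∘ P) as′ × a′ ~ v × Path v e rs × as′ ++ rs ↭ as ++ bs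
  scan P? {b = b} arm ¬ps e p any with P? b
  ... | yes pb = b , _ , _ , _ , pb , arm , ¬ps , e , p , ↭-refl
  scan P? arm ¬ps e end (here pb) | no ¬pb = contradiction pb ¬pb
  scan P? arm ¬ps e (f ∷ p) (here pb) | no ¬pb = contradiction pb ¬pb
  scan P? {as = as} {b = b} arm ¬ps e (f ∷ p) (there any) | no ¬pb with scan P? (~-sym e ∷ arm) (¬pb ∷ ¬ps) f p any
  ... | v , a′ , as′ , rs , pv , arm′ , ¬ps′ , e′ , q , perm =
    v , a′ , as′ , rs , pv , arm′ , ¬ps′ , e′ , q , ↭-trans perm (↭-sym (Permₚ.shift b as _))

  path-cons : ∀ {a b xs} → Path a b xs → ∃ λ ys → xs ≡ a ∷ ys
  path-cons end     = _ , refl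
  path-cons (_ ∷ _) = _ , refl

  rotate : ∀ {zs u} → Closing zs → u ∈ zs →
           ∃ λ b → ∃ λ ys → Path u b (u ∷ ys) × b ~ u × u ∷ ys ↭ zs × Unique (u ∷ ys)
  rotate (a , b , p , f , us) u∈ with suffix u∈ p
  ... | []     , y ∷ ys , q , refl with path-head q | path-head p
  ...   | refl | refl = b , ys , q , f , ↭-refl , us
  rotate (a , b , p , f , us) u∈ | z ∷ zs , y ∷ ys , q , refl with path-head q | path-head p | split z zs p
  ... | refl | refl | c , r , e , _ =
    c , ys ++ a ∷ zs , append q f r , e , perm , Unique-resp-↭ (↭-sym perm) us
    where
    perm : y ∷ ys ++ a ∷ zs ↭ a ∷ zs ++ y ∷ ys
    perm = Permₚ.++-comm (y ∷ ys) (a ∷ zs)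

  module Component {xs : List V} (closing : Closing xs) {x₀ y₀ : V} (x₀~y₀ : x₀ ~ y₀)
                   (x₀∉ : x₀ ∉ xs) (y₀∉ : y₀ ∉ xs) (max : NoLonger (length xs)) where

    H : V → Set
    H z = Walk G (_∉ xs) x₀ z

    H∉ : ∀ {z} → H z → z ∉ xs
    H∉ w = walk-start (walk-reverse w)

    H-step : ∀ {h z} → H h → h ~ z → z ∉ xs → H z
    H-step = walk-snoc

    H-≢ : ∀ {h z} → H h → z ∈ xs → h ≢ z
    H-≢ h z∈ refl = H∉ h z∈

    H-walk : ∀ {h z} → H h → Walk G (_∉ xs) h z → Walk G H h z
    H-walk h (here _)     = here h
    H-walk h (step _ e w) = step h e (H-walk (H-step h e (walk-start w)) w)

    H-path : ∀ {h h′} → H h → H h′ → ∃ λ hs → Path h h′ hs × Unique hs × All H hs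
    H-path h h′ = simple (H-walk h (walk-append (walk-reverse h) h′))

    H-neighbour : ∀ {h} → H h → ∃ λ t → H t × h ~ t
    H-neighbour h with walk-reverse h
    ... | here _     = y₀ , H-step h x₀~y₀ y₀∉ , x₀~y₀
    ... | step _ e w = _ , walk-reverse w , e

    Attached : V → Set
    Attached w = ∃ λ h → H h × w ~ h

    exit : ∀ {P h c} → Walk G P h c → H h → c ∈ xs →
           ∃ λ h′ → ∃ λ w → H h′ × P h′ × w ∈ xs × P w × h′ ~ w
    exit (here _) h c∈ = contradiction c∈ (H∉ h)
    exit (step {y = y} p e w) h c∈ with y ∈? xs
    ... | yes y∈ = _ , y , h , p , y∈ , walk-start w , e
    ... | no  y∉ = exit w (H-step h e y∉) c∈

    unique-xs : Unique xs
    unique-xs = proj₂ (proj₂ (proj₂ (proj₂ closing)))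

    with-outside : ∀ {hs ys} → All (_∉ xs) hs → Unique hs → ys ↭ hs ++ xs →
                   Unique ys × length ys ≡ length hs + length xs
    with-outside {hs} hs∉ us perm =
      Unique-resp-↭ (↭-sym perm) (Uniqueₚ.++⁺ us unique-xs λ (z∈ , z∈′) → All.lookup hs∉ z∈ z∈′) ,
      trans (Permₚ.↭-length perm) (Listₚ.length-++ hs)

    another : 3 ≤ length xs → ∀ c → ∃ λ c′ → c′ ∈ xs × c′ ≢ c
    another l c = go xs l unique-xs
      where
      go : ∀ ys → 3 ≤ length ys → Unique ys → ∃ λ c′ → c′ ∈ ys × c′ ≢ c
      go (_ ∷ []) (s≤s ()) _
      go (y ∷ z ∷ ys) l ((y≢z ∷ _) ∷ _) with y ≟ c
      ... | no y≢c   = y , here refl , y≢c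
      ... | yes refl = z , there (here refl) , y≢z ∘ sym

    -- Even after the removal of `c` the component is still linked to the rest of the cycle.
    attached-avoiding : TwoConnected G → 3 ≤ length xs → ∀ {c} → c ∈ xs → ∃ λ w → w ∈ xs × w ≢ c × Attached w
    attached-avoiding (_ , _ , conn-) l {c} c∈ with another l c
    ... | c′ , c′∈ , c′≢c with exit (conn- c x₀ c′ (H-≢ (here x₀∉) c∈) c′≢c) (here x₀∉) c′∈
    ...   | h , w , hh , _ , w∈ , w≢c , e = w , w∈ , w≢c , h , hh , ~-sym e

    -- The arms run from the far ends `a` and `d` towards `u`. The vertices `v` and `v′` may
    -- coincide, and then `back` is a single vertex.
    record Frame : Set where
      field
        {u v v′ a d}  : V
        {as rs ds}    : List V
        arm-a   : Arm u a as
        arm-d   : Arm u d ds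
        back    : Path v′ v rs
        a~v     : a ~ v
        d~v′    : d ~ v′
        att-u   : Attached u
        att-v   : Attached v
        att-v′  : Attached v′
        free-a  : All (¬_ ∘ Attached) as
        free-d  : All (¬_ ∘ Attached) ds
        cover   : u ∷ as ++ ds ++ rs ↭ xs

    frame : TwoConnected G → 3 ≤ length xs → (∀ z → Dec (H z)) → 
            ∀ {u} → u ∈ xs → Attached u → Σ Frame λ F → Frame.u F ≡ u
    frame tc l H? {u} u∈ att with rotate closing u∈ | attached-avoiding tc l u∈
    ... | _ , []     , _ , _ , perm , _ | w , w∈ , w≢u , _ =
      contradiction (Permₚ.∈-resp-↭ (↭-sym perm) w∈) λ { (here w≡u) → w≢u w≡u }
    ... | _ , y ∷ ys , e ∷ p , f , perm , _ | w , w∈ , w≢u , att-w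
      with scan Att? nil [] e p (any-att (Permₚ.∈-resp-↭ (↭-sym perm) w∈))
      where
      Att? : ∀ z → Dec (Attached z)
      Att? z = any? λ h → H? h ×-dec (z ~? h)
      any-att : w ∈ u ∷ y ∷ ys → Any Attached (y ∷ ys)
      any-att (here w≡u)  = contradiction w≡u w≢u
      any-att (there w∈ys) = Any.map (λ { refl → att-w }) w∈ys
    ... | v , a , as , rs , att-v , arm-a , free-a , a~v , q , perm₁
      -- Going backwards from `u`, the search stops at `v` at the latest.
      with scan (λ z → any? λ h → H? h ×-dec (z ~? h)) nil [] (~-sym f) (reversed q)
                (Any.map (λ { refl → att-v }) (last∈ (reversed q)))
    ... | v′ , d , ds , rs′ , att-v′ , arm-d , free-d , d~v′ , q′ , perm₂ = record
      { arm-a = arm-a ; arm-d = arm-d ; back = q′ ; a~v = a~v ; d~v′ = d~v′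
      ; att-u = att ; att-v = att-v ; att-v′ = att-v′ ; free-a = free-a ; free-d = free-d
      ; cover = ↭-trans (prep u (↭-trans (Permₚ.++⁺ˡ as (↭-trans perm₂ (Permₚ.↭-reverse rs))) perm₁)) perm
      } , refl

    module _ (F : Frame) where
      open Frame F

      -- The closed path runs through the rest of the cycle, down the arm to `u`, into `H` and back
      -- to `p`. Here `ls` are arc vertices left out and `es` are vertices picked up outside both
      -- the cycle and `H`; at least `h` is gained.
      close-up : ∀ {p q c ts qs ls es} → Path p q ts → ts ↭ rs → q ~ c → Arm u c qs → qs ++ ls ↭ es ++ as ++ ds →
                 All (λ e → e ∉ xs × ¬ H e) es → Unique es → Attached p →
                 ∃ λ zs → ∃ λ h → ∃ λ hs → Closing zs × H h × zs ++ ls ↭ xs ++ es ++ h ∷ hs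
      close-up {ts = ts} {qs = qs} {ls} {es} t t↭ q~c arm perm es∉ ues (h′ , hh′ , p~h′) with att-u
      ... | h , hh , u~h with H-path hh hh′
      ...   | hs , path , us , hs-H with path-cons path
      ...     | ys , refl = zs , h , ys ,
        (_ , _ , append t q~c (append (arm-path arm) u~h path) , ~-sym p~h′ ,
         Unique-++⁻ˡ zs (Unique-resp-↭ (↭-sym all↭) unique-all)) , hh , all↭
        where
        zs = ts ++ (qs ++ [ u ]) ++ h ∷ ys
        all↭ : zs ++ ls ↭ xs ++ es ++ h ∷ ys
        all↭ = ↭-trans
          (solve 5 (λ t q u h l → ((t ⊕ ((q ⊕ u) ⊕ h)) ⊕ l) ⊜ ((u ⊕ ((q ⊕ l) ⊕ t)) ⊕ h)) ↭-refl ts qs [ u ] (h ∷ ys) ls)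
          (↭-trans (Permₚ.++⁺ʳ (h ∷ ys) (prep u (Permₚ.++⁺ perm t↭)))
          (↭-trans (solve 6 (λ u e a d r h → ((u ⊕ ((e ⊕ (a ⊕ d)) ⊕ r)) ⊕ h) ⊜ ((u ⊕ (a ⊕ (d ⊕ r))) ⊕ (e ⊕ h))) ↭-refl [ u ] es as ds rs (h ∷ ys))
                   (Permₚ.++⁺ʳ (es ++ h ∷ ys) cover)))
        unique-all : Unique (xs ++ es ++ h ∷ ys)
        unique-all = proj₁ (with-outside (Allₚ.++⁺ (All.map proj₁ es∉) (All.map H∉ hs-H))
          (Uniqueₚ.++⁺ ues us λ (z∈ , z∈′) → proj₂ (All.lookup es∉ z∈) (All.lookup hs-H z∈′)) (Permₚ.++-comm xs _))

      reroute : ∀ {c qs ls es} → Arm u c qs → c ≡ a ⊎ c ≡ d → qs ++ ls ↭ es ++ as ++ ds →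
                All (λ e → e ∉ xs × ¬ H e) es → Unique es →
                ∃ λ zs → ∃ λ h → ∃ λ hs → Closing zs × H h × zs ++ ls ↭ xs ++ es ++ h ∷ hs
      reroute arm (inj₁ refl) perm es∉ ues = close-up back ↭-refl (~-sym a~v) arm perm es∉ ues att-v′
      reroute arm (inj₂ refl) perm es∉ ues = close-up (reversed back) (Permₚ.↭-reverse rs) (~-sym d~v′) arm perm es∉ ues att-v

      -- With nothing left out, the vertices of `H` are a net gain.
      no-merge : ∀ {c qs es} → Arm u c qs → c ≡ a ⊎ c ≡ d → qs ↭ es ++ as ++ ds →
                 All (λ e → e ∉ xs × ¬ H e) es → Unique es → ⊥
      no-merge {qs = qs} {es} arm c≡ perm es∉ ues with reroute {ls = []} arm c≡ (↭-trans (Permₚ.++-identityʳ qs) perm) es∉ ues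
      ... | zs , h , hs , (_ , _ , p , e , us) , _ , all↭ = ℕₚ.<⇒≱ (begin-strict
        length xs                          <⟨ ℕₚ.m<m+n (length xs) (ℕₚ.<-≤-trans (s≤s z≤n) (ℕₚ.m≤n+m _ (length es))) ⟩
        length xs + (length es + suc (length hs)) ≡⟨ cong (length xs +_) (Listₚ.length-++ es) ⟨
        length xs + length (es ++ h ∷ hs)  ≡⟨ Listₚ.length-++ xs ⟨
        length (xs ++ es ++ h ∷ hs)        ≡⟨ Permₚ.↭-length all↭ ⟨
        length (zs ++ [])                  ≡⟨ cong length (Listₚ.++-identityʳ zs) ⟩
        length zs                          ∎) (max p e us)
        where open ℕₚ.≤-Reasoning

    outward : ∀ {u a z zs} → Arm u a (z ∷ zs) → ∃ λ b → ∃ λ bs → Path b a (b ∷ bs) × u ~ b × b ∷ bs ↭ z ∷ zs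
    outward {u} {a} {z} {zs} arm with go arm
      where
      go : ∀ {u a z zs} → Arm u a (z ∷ zs) → ∃ λ b → Path a b (z ∷ zs) × b ~ u
      go (e ∷ nil)         = _ , end , e
      go (e ∷ r@(_ ∷ _)) with go r
      ... | b , p , f = b , e ∷ p , f
    ... | b , p , f with reversed p | path-cons (reversed p)
    ...   | q | bs , eq = b , bs , subst (Path b a) eq q , ~-sym f ,
      ↭-trans (↭-reflexive (sym eq)) (Permₚ.↭-reverse (z ∷ zs))

    framed : TwoConnected G → 3 ≤ length xs → ((∀ z → Dec (H z)) → ¬ Frame) → ⊥
    framed tc l ¬frame with another l x₀
    ... | c , c∈ , _ with attached-avoiding tc l c∈
    ...   | u , u∈ , _ , att = decide-all (size G) λ H? → ¬frame H? (proj₁ (frame tc l H? u∈ att))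

-- P₄ and W

module CographCase (G : Graph) (tc : TwoConnected G) (P4-free : Free P4 G) (W-free : Free W G) where
  open Components G

  module _ {xs : List V} (closing : Closing xs) {x₀ y₀ : V} (x₀~y₀ : x₀ ~ y₀)
           (x₀∉ : x₀ ∉ xs) (y₀∉ : y₀ ∉ xs) (max : NoLonger (length xs)) where
    open Component closing x₀~y₀ x₀∉ y₀∉ max

    no-P4 : ∀ {a b c d} → a ~ b → b ~ c → c ~ d → a ≁ c → a ≁ d → b ≁ d → ⊥
    no-P4 ab bc cd ac ad bd = P4-free (induced P4 (_ ∷ _ ∷ _ ∷ _ ∷ []) ((ab , ac , ad) , (bc , bd) , cd))

    -- A non-attached `f` sees nothing of `H`. So along an edge x y of `H` with w ~ x and w ≁ y, the
    -- path y, x, w, f would be induced; adjacency to `w` therefore spreads over the component.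
    complete : ∀ {w f} → Attached w → w ~ f → ¬ Attached f → ∀ {h} → H h → w ~ h
    complete {w} {f} (h₀ , hh₀ , w~h₀) w~f ¬att hh =
      spread (H-walk hh₀ (walk-append (walk-reverse hh₀) hh)) w~h₀
      where
      spread : ∀ {h h′} → Walk G H h h′ → w ~ h → w ~ h′
      spread (here _)     e = e
      spread (step {x} {y} hx e r) w~x = spread r (decidable-stable (w ~? y) λ w≁y →
        no-P4 (~-sym e) (~-sym w~x) w~f (≁-sym w≁y)
          (λ g → ¬att (_ , walk-start r , ~-sym g)) (λ g → ¬att (_ , hx , ~-sym g)))

    -- Going outwards, the first arm vertex not adjacent to `u` would form an induced path with `h`,
    -- `u` and the vertex before it.
    dominated : ∀ {u a as h} → H h → u ~ h → Arm u a as → All (¬_ ∘ Attached) as → All (u ~_) as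
    dominated hh u~h nil _ = []
    dominated hh u~h (e ∷ nil) _ = ~-sym e ∷ []
    dominated {u} {a} hh u~h (e ∷ r@(_ ∷ _)) (¬a ∷ ¬as@(¬b ∷ _)) with dominated hh u~h r ¬as
    ... | u~bs@(u~b ∷ _) = decidable-stable (u ~? a) (λ u≁a →
      no-P4 (~-sym u~h) u~b (~-sym e) (λ g → ¬b (_ , hh , ~-sym g)) (λ g → ¬a (_ , hh , ~-sym g)) u≁a) ∷ u~bs

    contradictory : Frame → ⊥
    contradictory F@record { arm-a = nil } = no-merge F (Frame.arm-d F) (inj₂ refl) ↭-refl [] []
    contradictory F@record { arm-a = _ ∷ _ ; arm-d = nil } =
      no-merge F (Frame.arm-a F) (inj₁ refl) (↭-sym (Permₚ.++-identityʳ _)) [] []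
    contradictory record { u = u ; v = v ; v′ = v′ ; a = a ; d = d ; rs = rs
                         ; arm-a = arm-a@(_ ∷ _) ; arm-d = arm-d@(_ ∷ _) ; back = back ; a~v = a~v ; d~v′ = d~v′
                         ; att-u = att-u@(x , hx , u~x) ; att-v = att-v ; att-v′ = att-v′
                         ; free-a = free-a ; free-d = free-d ; cover = cover }
      with H-neighbour hx | outward arm-a | outward arm-d
    ... | y , hy , x~y | a₁ , as , path-a , u~a₁ , as↭ | b₁ , bs , path-b , u~b₁ , bs↭ = go path-a path-b
      where
      free-a′ = Permₚ.All-resp-↭ (↭-sym as↭) free-a
      free-d′ = Permₚ.All-resp-↭ (↭-sym bs↭) free-d
      u~as = Permₚ.All-resp-↭ (↭-sym as↭) (dominated hx u~x arm-a free-a)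
      u~bs = Permₚ.All-resp-↭ (↭-sym bs↭) (dominated hx u~x arm-d free-d)
      v~ : ∀ {h} → H h → v ~ h
      v~ = complete att-v (~-sym a~v) (All.head free-a)
      v′~ : ∀ {h} → H h → v′ ~ h
      v′~ = complete att-v′ (~-sym d~v′) (All.head free-d)
      u~y : u ~ y
      u~y = complete att-u u~a₁ (All.head free-a′) hy
      setup : ∀ {ys zs} → ys ++ zs ↭ (a₁ ∷ as) ++ b₁ ∷ bs → 
              Unique (x ∷ y ∷ ys ++ zs ++ rs ++ u ∷ []) × length (x ∷ y ∷ ys ++ zs ++ rs ++ u ∷ []) ≡ 2 + length xs
      setup {ys} {zs} p = with-outside (H∉ hx ∷ H∉ hy ∷ []) ((~⇒≢ x~y ∷ []) ∷ [] ∷ []) (prep x (prep y (↭-trans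
        (solve 4 (λ y z r u → (y ⊕ (z ⊕ (r ⊕ u))) ⊜ (u ⊕ ((y ⊕ z) ⊕ r))) ↭-refl ys zs rs (u ∷ []))
        (↭-trans (prep u (Permₚ.++⁺ʳ rs (↭-trans p (Permₚ.++⁺ as↭ bs↭))))
          (↭-trans (↭-reflexive (cong (u ∷_) (Listₚ.++-assoc (_ ∷ _) (_ ∷ _) rs))) cover)))))
      -- Two vertices of `H` enter, so a tour that omits at most one vertex is too long.
      short : ∀ {L k} → L ≡ 2 + length xs → L ≤ length xs + k → {True (k ℕ.≤? 1)} → ⊥
      short eq le {k≤1} = ℕₚ.<⇒≱ (ℕₚ.≤-reflexive (trans (cong suc (ℕₚ.+-comm (length xs) 1)) (sym eq)))
        (ℕₚ.≤-trans le (ℕₚ.+-monoʳ-≤ (length xs) (toWitness k≤1)))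
      go : Path a₁ a (a₁ ∷ as) → Path b₁ d (b₁ ∷ bs) → ⊥
      -- An arc with a single vertex is skipped in favour of `x` and `y`.
      go end path-b = short len (tour (fw 4) (fw 2 ∷ fw 3 ∷ bw 0 ∷ []) (# 1 ∷ [])
        (u~b₁ , d~v′ , v~ hy , ~-sym u~x))
        where
        us×len = setup {a₁ ∷ []} {b₁ ∷ bs} ↭-refl
        len = proj₂ us×len
        open Exchange max (seg (x~y ∷ end) ∷ single a₁ ∷ seg path-b ∷ seg back ∷ single u ∷ []) (proj₁ us×len)
      go path-a@(_ ∷ _) end = short len (tour (fw 4) (fw 2 ∷ bw 3 ∷ bw 0 ∷ []) (# 1 ∷ [])
        (u~a₁ , a~v , v′~ hy , ~-sym u~x))
        where
        us×len = setup {b₁ ∷ []} {a₁ ∷ as} (Permₚ.++-comm (b₁ ∷ []) (a₁ ∷ as))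
        len = proj₂ us×len
        open Exchange max (seg (x~y ∷ end) ∷ single b₁ ∷ seg path-a ∷ seg back ∷ single u ∷ []) (proj₁ us×len)
      -- Tours exclude all edges between {a₁, a₂} and {b₁, b₂} except a₂ b₂, and that one would give
      -- the induced path a₁, a₂, b₂, b₁. What is left is `W` with centre `u` and the edges x y, a₁
      -- a₂, b₁ b₂.
      go (_∷_ {b = a₂} a₁~a₂ path-a) (_∷_ {b = b₂} b₁~b₂ path-b) =
        case-⊥ {a₂ ~ b₂}
          (λ a₂~b₂ → no-P4 a₁~a₂ a₂~b₂ (~-sym b₁~b₂) a₁≁b₂ a₁≁b₁ a₂≁b₁)
          (λ a₂≁b₂ → W-free (induced W (u ∷ x ∷ y ∷ a₁ ∷ a₂ ∷ b₁ ∷ b₂ ∷ [])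
            ( (u~x , u~y , u~a₁ , u~a₂ , u~b₁ , u~b₂)
            , (x~y , off hx a₁-free , off hx a₂-free , off hx b₁-free , off hx b₂-free)
            , (off hy a₁-free , off hy a₂-free , off hy b₁-free , off hy b₂-free)
            , (a₁~a₂ , a₁≁b₁ , a₁≁b₂) , (a₂≁b₁ , a₂≁b₂) , b₁~b₂)))
        where
        us×len = setup {a₁ ∷ as} {b₁ ∷ bs} ↭-refl
        len = proj₂ us×len
        open Exchange max (seg (x~y ∷ end) ∷ single a₁ ∷ seg path-a ∷ single b₁ ∷ seg path-b ∷ seg back ∷ single u ∷ [])
          (proj₁ us×len)
        off : ∀ {h f} → H h → ¬ Attached f → h ≁ f
        off hh ¬att e = ¬att (_ , hh , ~-sym e)
        a₁-free = All.head free-a′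
        b₁-free = All.head free-d′
        a₂-free = All.lookup free-a′ (there (head∈ path-a))
        b₂-free = All.lookup free-d′ (there (head∈ path-b))
        u~a₂ = All.lookup u~as (there (head∈ path-a))
        u~b₂ = All.lookup u~bs (there (head∈ path-b))
        u~a = All.lookup u~as (there (last∈ path-a))
        u~d = All.lookup u~bs (there (last∈ path-b))
        a₁≁b₁ : a₁ ≁ b₁
        a₁≁b₁ e = short len (tour (fw 6) (bw 2 ∷ bw 1 ∷ fw 3 ∷ fw 4 ∷ fw 5 ∷ bw 0 ∷ []) []
          (u~a , ~-sym a₁~a₂ , e , b₁~b₂ , d~v′ , v~ hy , ~-sym u~x))
        a₁≁b₂ : a₁ ≁ b₂
        a₁≁b₂ e = short len (tour (fw 6) (bw 2 ∷ bw 1 ∷ fw 4 ∷ fw 5 ∷ bw 0 ∷ []) (# 3 ∷ [])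
          (u~a , ~-sym a₁~a₂ , e , d~v′ , v~ hy , ~-sym u~x))
        a₂≁b₁ : a₂ ≁ b₁
        a₂≁b₁ e = short len (tour (fw 6) (bw 4 ∷ bw 3 ∷ fw 2 ∷ bw 5 ∷ bw 0 ∷ []) (# 1 ∷ [])
          (u~d , ~-sym b₁~b₂ , ~-sym e , a~v , v′~ hy , ~-sym u~x))

  not-extremal : ¬ Extremal
  not-extremal (_ , c , l , max , _ , _ , _ , e , x∉ , y∉) =
    Component.framed c e x∉ y∉ max tc l (λ _ → contradictory c e x∉ y∉ max)

-- Cycles with an outside chord

module Thetas (G : Graph) where
  open Components G public

  module Theory {xs : List V} (closing : Closing xs) {x₀ y₀ : V} (x₀~y₀ : x₀ ~ y₀)
                (x₀∉ : x₀ ∉ xs) (y₀∉ : y₀ ∉ xs) (max : NoLonger (length xs)) where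
    open Component closing x₀~y₀ x₀∉ y₀∉ max public

    -- The cycle through u, A, v, D with a chord X outside it; A runs from u to v, D from v to u.
    record Theta : Set where
      field
        {u v x y a a′ d d′} : V
        {X A D} : List V
        path-x : Path x y X
        path-a : Path a a′ A
        path-d : Path d d′ D
        u~x  : u ~ x
        y~v  : y ~ v
        u~a  : u ~ a
        a′~v : a′ ~ v
        v~d  : v ~ d
        d′~u : d′ ~ u
        outside  : All H X
        unique-x : Unique X
        cover    : A ++ D ++ u ∷ v ∷ [] ↭ xs

    exchange : ∀ {hs ys} → All H hs → Unique hs → 0 < length hs → ys ↭ hs ++ xs → Unique ys × length xs < length ys
    exchange {hs} hH us pos perm with with-outside (All.map H∉ hH) us perm
    ... | us′ , eq = us′ , subst (length xs <_) (sym eq) (ℕₚ.m<n+m (length xs) pos)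

    path-pos : ∀ {a b zs} → Path a b zs → 0 < length zs
    path-pos end     = s≤s z≤n
    path-pos (_ ∷ _) = s≤s z≤n

    swap-arcs : Theta → Theta
    swap-arcs T = record
      { path-x = path-x ; path-a = reversed path-d ; path-d = reversed path-a
      ; u~x = u~x ; y~v = y~v ; u~a = ~-sym d′~u ; a′~v = ~-sym v~d ; v~d = ~-sym a′~v ; d′~u = ~-sym u~a
      ; outside = outside ; unique-x = unique-x
      ; cover = ↭-trans (Permₚ.++⁺ (Permₚ.↭-reverse D) (Permₚ.++⁺ʳ _ (Permₚ.↭-reverse A)))
                        (↭-trans (Permₚ.shifts D A) cover)
      }
      where open Theta T

    mirror : Theta → Theta
    mirror T = record
      { path-x = reversed path-x ; path-a = reversed path-a ; path-d = reversed path-d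
      ; u~x = ~-sym y~v ; y~v = ~-sym u~x ; u~a = ~-sym a′~v ; a′~v = ~-sym u~a ; v~d = ~-sym d′~u ; d′~u = ~-sym v~d
      ; outside = Permₚ.All-resp-↭ (↭-sym (Permₚ.↭-reverse X)) outside
      ; unique-x = Unique-resp-↭ (↭-sym (Permₚ.↭-reverse X)) unique-x
      ; cover = ↭-trans (Permₚ.++⁺ (Permₚ.↭-reverse A) (Permₚ.++⁺ (Permₚ.↭-reverse D) (swap _ _ ↭-refl))) cover
      }
      where open Theta T

    module Arcs (T : Theta) where
      open Theta T

      whole : Unique (X ++ A ++ D ++ u ∷ v ∷ []) × length xs < length (X ++ A ++ D ++ u ∷ v ∷ [])
      whole = exchange outside unique-x (path-pos path-x) (Permₚ.++⁺ˡ X cover)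

      open Exchange max (seg path-x ∷ seg path-a ∷ seg path-d ∷ single u ∷ single v ∷ []) (proj₁ whole)

      ∈A⇒∈xs : ∀ {z} → z ∈ A → z ∈ xs
      ∈A⇒∈xs z∈ = Permₚ.∈-resp-↭ cover (∈-++⁺ˡ z∈)

      ∈D⇒∈xs : ∀ {z} → z ∈ D → z ∈ xs
      ∈D⇒∈xs z∈ = Permₚ.∈-resp-↭ cover (∈-++⁺ʳ A (∈-++⁺ˡ z∈))

      u∈xs : u ∈ xs
      u∈xs = Permₚ.∈-resp-↭ cover (∈-++⁺ʳ A (∈-++⁺ʳ D (here refl)))

      v∈xs : v ∈ xs
      v∈xs = Permₚ.∈-resp-↭ cover (∈-++⁺ʳ A (∈-++⁺ʳ D (there (here refl))))

      unique-parts : Unique (A ++ D ++ u ∷ v ∷ [])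
      unique-parts = Unique-++⁻ʳ X (proj₁ whole)

      -- This and the next five adjacencies would each let a tour take in the whole cycle together
      -- with `X`.
      y≁a : y ≁ a
      y≁a e = full-tour (proj₂ whole) (fw 3) (fw 0 ∷ fw 1 ∷ fw 4 ∷ fw 2 ∷ []) (u~x , e , a′~v , v~d , d′~u)

      x≁a′ : x ≁ a′
      x≁a′ e = full-tour (proj₂ whole) (fw 1) (fw 0 ∷ fw 4 ∷ fw 2 ∷ fw 3 ∷ []) (~-sym e , y~v , v~d , d′~u , u~a)

      x≁d : x ≁ d
      x≁d e = full-tour (proj₂ whole) (fw 4) (bw 0 ∷ fw 2 ∷ fw 3 ∷ fw 1 ∷ []) (~-sym y~v , e , d′~u , u~a , a′~v)

      y≁d′ : y ≁ d′
      y≁d′ e = full-tour (proj₂ whole) (fw 2) (bw 0 ∷ fw 3 ∷ fw 1 ∷ fw 4 ∷ []) (~-sym e , ~-sym u~x , u~a , a′~v , v~d)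

      a≁d : a ≁ d
      a≁d e = full-tour (proj₂ whole) (fw 3) (fw 0 ∷ fw 4 ∷ bw 1 ∷ fw 2 ∷ []) (u~x , y~v , ~-sym a′~v , e , d′~u)

      a′≁d′ : a′ ≁ d′
      a′≁d′ e = full-tour (proj₂ whole) (fw 3) (fw 1 ∷ bw 2 ∷ fw 4 ∷ bw 0 ∷ []) (u~a , e , ~-sym v~d , ~-sym y~v , ~-sym u~x)

      module _ (a~d′ : a ~ d′) (a′~d : a′ ~ d) where

        -- The edges `a~d′` and `a′~d` bypass `u` and `v`; one more edge at an arc end then
        -- completes a full tour. In claw-free graphs the two bypasses come from the neighbourhoods
        -- of `u` and `v`.
        a≁v : a ≁ v
        a≁v e = full-tour (proj₂ whole) (bw 1) (fw 4 ∷ bw 0 ∷ fw 3 ∷ bw 2 ∷ []) (e , ~-sym y~v , ~-sym u~x , ~-sym d′~u , ~-sym a′~d)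

        a′≁u : a′ ≁ u
        a′≁u e = full-tour (proj₂ whole) (fw 3) (fw 0 ∷ fw 4 ∷ fw 2 ∷ fw 1 ∷ []) (u~x , y~v , v~d , ~-sym a~d′ , e)

        d≁u : d ≁ u
        d≁u e = full-tour (proj₂ whole) (fw 3) (fw 0 ∷ fw 4 ∷ bw 1 ∷ bw 2 ∷ []) (u~x , y~v , ~-sym a′~v , a~d′ , e)

        d′≁v : d′ ≁ v
        d′≁v e = full-tour (proj₂ whole) (fw 3) (fw 1 ∷ fw 2 ∷ fw 4 ∷ bw 0 ∷ []) (u~a , a′~d , e , ~-sym y~v , ~-sym u~x)

      A#D : ∀ {z w} → z ∈ A → w ∈ D → z ≢ w
      A#D z∈ w∈ = Unique-disjoint A unique-parts z∈ (∈-++⁺ˡ w∈)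

      record Interior (w : V) : Set where
        field
          {b c}    : V
          {A₁ A₂}  : List V
          before   : Path a b A₁
          after    : Path c a′ A₂
          b~w      : b ~ w
          w~c      : w ~ c
          whole-a  : A ≡ A₁ ++ w ∷ A₂

      interior : ∀ {w} → w ∈ A → w ≢ a → w ≢ a′ → Interior w
      interior w∈ w≢a w≢a′ with ∈-∃++ w∈
      ... | A₁ , A₂ , eq = go A₁ A₂ eq path-a
        where
        go : ∀ A₁ A₂ → A ≡ A₁ ++ _ ∷ A₂ → Path a a′ A → Interior _
        go [] A₂ refl p = contradiction (sym (path-head p)) w≢a
        go (z ∷ A₁) A₂ refl p with split z A₁ p
        go (z ∷ A₁) [] refl p | b , q , b~w , end = contradiction refl w≢a′
        go (z ∷ A₁) (_ ∷ A₂) refl p | b , q , b~w , (f ∷ r) with path-head r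
        ... | refl = record { before = q ; after = r ; b~w = b~w ; w~c = f ; whole-a = refl }

      module Split {w : V} (I : Interior w) where
        open Interior I

        refined : X ++ A₁ ++ w ∷ A₂ ++ D ++ u ∷ v ∷ [] ≡ X ++ A ++ D ++ u ∷ v ∷ []
        refined = cong (X ++_) (trans (sym (Listₚ.++-assoc A₁ (w ∷ A₂) (D ++ u ∷ v ∷ []))) (cong (_++ D ++ u ∷ v ∷ []) (sym whole-a)))

        module E = Exchange max (seg path-x ∷ seg before ∷ single w ∷ seg after ∷ seg path-d ∷ single u ∷ single v ∷ [])
          (subst Unique (sym refined) (proj₁ whole))

        bigger : length xs < length (X ++ A₁ ++ w ∷ A₂ ++ D ++ u ∷ v ∷ [])
        bigger = subst (λ zs → length xs < length zs) (sym refined) (proj₂ whole)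

        c≁d : w ~ d′ → c ≁ d
        c≁d w~d′ e = E.full-tour bigger (fw 6) (bw 3 ∷ fw 4 ∷ fw 2 ∷ bw 1 ∷ fw 5 ∷ fw 0 ∷ [])
          (~-sym a′~v , e , ~-sym w~d′ , ~-sym b~w , ~-sym u~a , u~x , y~v)

        c≁a : w ~ d → c ≁ a
        c≁a w~d e = E.full-tour bigger (fw 6) (bw 3 ∷ fw 1 ∷ fw 2 ∷ fw 4 ∷ fw 5 ∷ fw 0 ∷ [])
          (~-sym a′~v , e , b~w , w~d , d′~u , u~x , y~v)

        c∈A : c ∈ A
        c∈A = subst (c ∈_) (sym whole-a) (∈-++⁺ʳ A₁ (there (head∈ after)))

        c≢a : c ≢ a
        c≢a refl = Unique-disjoint A₁ (subst Unique whole-a (Unique-++⁻ˡ A unique-parts)) (head∈ before) (there (head∈ after)) refl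

    record Chord (u v x y : V) (X : List V) : Set where
      constructor chord
      field
        path    : Path x y X
        inside  : All H X
        simple-path : Unique X
        start   : u ~ x
        finish  : y ~ v

    -- Neither arc is empty: between consecutive vertices `u` and `v` of the cycle the chord could
    -- be inserted.
    theta-at : ∀ {u v x y X b} → Chord u v x y X → ∀ A D → Path u b (u ∷ A ++ v ∷ D) → b ~ u → u ∷ A ++ v ∷ D ↭ xs →
               Σ Theta λ T → Theta.u T ≡ u × Theta.v T ≡ v × Theta.x T ≡ x × Theta.y T ≡ y × Theta.A T ≡ A
    theta-at {u} {v} {x} {y} {X} {b} (chord p hX uX u~x y~v) = go
      where
      longer : ∀ {c d zs} → Path c d zs → d ~ c → zs ↭ X ++ xs → ⊥
      longer r e perm with exchange hX uX (path-pos p) perm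
      ... | us , lt = ℕₚ.<⇒≱ lt (max r e us)
      go : ∀ A D → Path u b (u ∷ A ++ v ∷ D) → b ~ u → u ∷ A ++ v ∷ D ↭ xs →
           Σ Theta λ T → Theta.u T ≡ u × Theta.v T ≡ v × Theta.x T ≡ x × Theta.y T ≡ y × Theta.A T ≡ A
      go [] D (e ∷ q) b~u perm with path-head q
      ... | refl = ⊥-elim (longer (append (u~x ∷ p) y~v q) b~u
        (↭-trans (↭-sym (Permₚ.shift u X (v ∷ D))) (Permₚ.++⁺ˡ X perm)))
      go (a ∷ A) D q b~u perm with split u (a ∷ A) q
      ... | a′ , e ∷ r , a′~v , s with path-head r
      go (a ∷ A) [] q b~u perm | a′ , e ∷ r , a′~v , end | refl =
        ⊥-elim (longer (append (append (e ∷ r) a′~v end) (~-sym y~v) (reversed p)) (~-sym u~x)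
          (↭-trans (Permₚ.++-comm (u ∷ a ∷ A ++ v ∷ []) (reverse X))
            (Permₚ.++⁺ (Permₚ.↭-reverse X) perm)))
      go (a ∷ A) (d ∷ D) q b~u perm | a′ , e ∷ r , a′~v , f ∷ s | refl with path-head s
      ... | refl = record
        { path-x = p ; path-a = r ; path-d = s ; u~x = u~x ; y~v = y~v ; u~a = e ; a′~v = a′~v ; v~d = f ; d′~u = b~u
        ; outside = hX ; unique-x = uX
        ; cover = ↭-trans (solve 4 (λ u a v d → (a ⊕ (d ⊕ (u ⊕ v))) ⊜ (u ⊕ (a ⊕ (v ⊕ d)))) ↭-refl [ u ] (a ∷ A) [ v ] (d ∷ D)) perm
        } , refl , refl , refl , refl , refl

    theta : ∀ {u v x y X} → u ∈ xs → v ∈ xs → u ≢ v → Chord u v x y X →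
            Σ Theta λ T → Theta.u T ≡ u × Theta.v T ≡ v × Theta.x T ≡ x × Theta.y T ≡ y
    theta u∈ v∈ u≢v c with rotate closing u∈
    ... | b , ys , q , b~u , perm , _ with Permₚ.∈-resp-↭ (↭-sym perm) v∈
    ...   | here v≡u = contradiction (sym v≡u) u≢v
    ...   | there v∈ys with ∈-∃++ v∈ys
    ...     | A , D , refl with theta-at c A D q b~u perm
    ...       | T , u≡ , v≡ , x≡ , y≡ , _ = T , u≡ , v≡ , x≡ , y≡

    -- `d′` and `u` are consecutive on the cycle, so a path through `H` from `h` to `x` could be
    -- inserted between them.
    tip-apart : ∀ T {h} → H h → Theta.d′ T ≁ h
    tip-apart T hh e with H-path (All.lookup outside (head∈ path-x)) hh
      where open Theta T
    ... | hs , p , us , hs-H with exchange hs-H us (path-pos p) (Permₚ.++⁺ˡ hs cover)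
      where open Theta T
    ...   | us′ , lt = full-tour lt (fw 2) (bw 0 ∷ fw 3 ∷ fw 1 ∷ fw 4 ∷ []) (e , ~-sym u~x , u~a , a′~v , v~d)
      where
      open Theta T
      open Exchange max (seg p ∷ seg path-a ∷ seg path-d ∷ single u ∷ single v ∷ []) us′

-- Distance levels in claw-free graphs

module Levels (G : Graph) where
  open Thetas G public

  module Search {U : V → Set} (U? : ∀ z → Dec (U z)) {r : V} (r∈U : U r) where

    -- Distance at most `n` from `r` inside `U`, put as a recursion on `n` to make it decidable.
    Ball : ℕ → V → Set
    Ball zero    z = z ≡ r
    Ball (suc n) z = Ball n z ⊎ (U z × ∃ λ w → Ball n w × w ~ z)

    Ball? : ∀ n z → Dec (Ball n z)
    Ball? zero    z = z ≟ r
    Ball? (suc n) z = Ball? n z ⊎-dec U? z ×-dec any? λ w → Ball? n w ×-dec (w ~? z)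

    Ball-mono : ∀ {m n z} → m ≤ n → Ball m z → Ball n z
    Ball-mono m≤n = go (ℕₚ.≤⇒≤′ m≤n)
      where
      go : ∀ {m n z} → m ℕ.≤′ n → Ball m z → Ball n z
      go (ℕ.≤′-reflexive refl) b = b
      go (ℕ.≤′-step m≤n)       b = inj₁ (go m≤n b)

    Level : ℕ → V → Set
    Level n z = Ball n z × (∀ {m} → m < n → ¬ Ball m z)

    level : ∀ n {z} → Ball n z → ∃ λ m → Level m z
    level zero    b = 0 , b , λ ()
    level (suc n) {z} b with Ball? n z
    ... | yes b′ = level n b′
    ... | no ¬b  = suc n , b , λ m<1+n b′ → ¬b (Ball-mono (ℕₚ.≤-pred m<1+n) b′)

    level-U : ∀ n {z} → Level n z → U z
    level-U zero    (refl , _)          = r∈U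
    level-U (suc n) (inj₁ b , new)      = contradiction b (new (ℕₚ.n<1+n n))
    level-U (suc n) (inj₂ (uz , _) , _) = uz

    parent : ∀ n {z} → Level (suc n) z → ∃ λ w → Level n w × w ~ z
    parent n (inj₁ b , new)                      = contradiction b (new (ℕₚ.n<1+n n))
    parent n (inj₂ (uz , w , bw , e) , new) = w , (bw , λ m<n b → new (s≤s m<n) (inj₂ (uz , w , b , e))) , e

    level-step : ∀ {m n w z} → Level m w → Level n z → w ~ z → n ≤ suc m
    level-step {m} {n} {w} (bw , _) lz@(_ , new) e =
      ℕₚ.≮⇒≥ λ 1+m<n → new 1+m<n (inj₂ (level-U n lz , w , bw , e))

    level-unique : ∀ {m n z} → Level m z → Level n z → m ≡ n
    level-unique (b , new) (b′ , new′) =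
      ℕₚ.≤-antisym (ℕₚ.≮⇒≥ λ n<m → new n<m b′) (ℕₚ.≮⇒≥ λ m<n → new′ m<n b)

    level-≁ : ∀ {m n w z} → Level m w → Level n z → suc m < n → w ≁ z
    level-≁ lw lz lt e = ℕₚ.<⇒≱ lt (level-step lw lz e)

    level-≢ : ∀ {m n w z} → Level m w → Level n z → m ≢ n → w ≢ z
    level-≢ lw lz m≢n refl = m≢n (level-unique lw lz)

module ClawFree (G : Graph) (claw-free : Free K13 G) where
  open Levels G public

  no-claw : ∀ {c a b d} → c ~ a → c ~ b → c ~ d → a ≢ b → a ≢ d → b ≢ d → a ≁ b → a ≁ d → b ≁ d → ⊥
  no-claw ca cb cd a≢b a≢d b≢d = claw claw-free a≢b a≢d b≢d ca cb cd

  module Chain {xs : List V} (closing : Closing xs) {x₀ y₀ : V} (x₀~y₀ : x₀ ~ y₀)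
               (x₀∉ : x₀ ∉ xs) (y₀∉ : y₀ ∉ xs) (max : NoLonger (length xs)) where
    open Theory closing x₀~y₀ x₀∉ y₀∉ max public

    module _ (F : Frame) {x : V} (hx : H x) (u~x : Frame.u F ~ x) where
      open Frame F

      S : List V
      S = u ∷ as ++ ds

      open Search (_∈? (x ∷ S)) {x} (here refl) public

      covered : S ++ rs ↭ xs
      covered = ↭-trans (↭-reflexive (cong (u ∷_) (Listₚ.++-assoc as ds rs))) cover

      ∈-xs : ∀ {z} → z ∈ S → z ∈ xs
      ∈-xs z∈ = Permₚ.∈-resp-↭ covered (∈-++⁺ˡ z∈)

      unique-S : Unique S
      unique-S = Unique-++⁻ˡ S (Unique-resp-↭ (↭-sym covered) unique-xs)

      off-root : ∀ {z} → z ∈ as ++ ds → z ≁ x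
      off-root z∈ z~x with ∈-++⁻ as z∈
      ... | inj₁ z∈as = All.lookup free-a z∈as (x , hx , z~x)
      ... | inj₂ z∈ds = All.lookup free-d z∈ds (x , hx , z~x)

      level-0 : ∀ {z} → Level 0 z → z ≡ x
      level-0 = proj₁

      -- Arc vertices are not attached, so within the searched set the root `x` has only the
      -- neighbour `u`.
      level-1 : ∀ {z} → Level 1 z → z ≡ u
      level-1 lz with level-U 1 lz | parent 0 lz
      ... | here refl           | _ , (refl , _) , e = contradiction e ≁-refl
      ... | there (here z≡u)    | _                  = z≡u
      ... | there (there z∈)    | _ , (refl , _) , e = contradiction (~-sym e) (off-root z∈)

      level-body : ∀ {n z} → Level (2 + n) z → z ∈ as ++ ds
      level-body {n} lz with level-U (2 + n) lz
      ... | here refl        = contradiction refl (proj₂ lz {0} (s≤s z≤n))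
      ... | there (here refl) = contradiction (inj₂ (there (here refl) , x , refl , ~-sym u~x)) (proj₂ lz {1} (s≤s (s≤s z≤n)))
      ... | there (there z∈) = z∈

      lu : Level 1 u
      lu = inj₂ (there (here refl) , x , refl , ~-sym u~x) ,
           λ { {zero} _ u≡x → ~⇒≢ u~x u≡x ; {suc _} (s≤s ()) }

      -- The configuration is an induced `N111` on the triangle p, w, w′. It is excluded by
      -- hypothesis because for {`K13`, `B12`} this takes an argument of its own.
      Net : Set
      Net = ∀ {n p₀ p w w′ z z′} → Level n p₀ → Level (1 + n) p → Level (2 + n) w → Level (2 + n) w′ →
            Level (3 + n) z → Level (3 + n) z′ → p₀ ~ p → p ~ w → p ~ w′ → w ~ w′ → w ~ z → w′ ~ z′ →
            w ≁ z′ → w′ ≁ z → z ≁ z′ → ⊥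

      module _ (no-net : Net) where

        siblings : ∀ {n w z z′} → Level (1 + n) w → Level (2 + n) z → Level (2 + n) z′ →
                   w ~ z → w ~ z′ → z ≢ z′ → z ≁ z′ → ⊥
        siblings {n} lw lz lz′ e e′ z≢z′ z≁z′ with parent n lw
        ... | g , lg , f = no-claw (~-sym f) e e′ (level-≢ lg lz (λ ())) (level-≢ lg lz′ (λ ())) z≢z′
          (level-≁ lg lz ℕₚ.≤-refl) (level-≁ lg lz′ ℕₚ.≤-refl) z≁z′

        -- Nonadjacent `z` and `z′` have no common neighbour one level below, by `siblings`. So
        -- their parents differ and are adjacent by induction; a parent of the one sees the other,
        -- or else there is a claw, and `Net` applies. On level 2 the only parent is `u`.
        clique : ∀ n {z z′} → Level (2 + n) z → Level (2 + n) z′ → z ≢ z′ → z ~ z′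
        clique n {z} {z′} lz lz′ z≢z′ = decidable-stable (z ~? z′) λ z≁z′ → absurd n lz lz′ z≢z′ z≁z′
          where
          absurd : ∀ n {z z′} → Level (2 + n) z → Level (2 + n) z′ → z ≢ z′ → z ≁ z′ → ⊥
          absurd n {z} {z′} lz lz′ z≢z′ z≁z′ with parent (1 + n) lz | parent (1 + n) lz′
          ... | w , lw , w~z | w′ , lw′ , w′~z′ with w ~? z′ | w′ ~? z
          ...   | yes e | _ = siblings lw lz lz′ w~z e z≢z′ z≁z′
          ...   | no _ | yes e = siblings lw′ lz lz′ e w′~z′ z≢z′ z≁z′
          absurd zero lz lz′ z≢z′ z≁z′ | w , lw , w~z | w′ , lw′ , w′~z′ | no w≁z′ | no _
            with level-1 lw | level-1 lw′
          ... | refl | refl = w≁z′ w′~z′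
          absurd (suc n) {z} {z′} lz lz′ z≢z′ z≁z′ | w , lw , w~z | w′ , lw′ , w′~z′ | no w≁z′ | no w′≁z
            with clique n lw lw′ (λ { refl → w≁z′ w′~z′ }) | parent (1 + n) lw
          ... | w~w′ | p , lp , p~w with p ~? w′ | parent n lp
          ...   | yes p~w′ | p₀ , lp₀ , p₀~p =
            no-net lp₀ lp lw lw′ lz lz′ p₀~p p~w p~w′ w~w′ w~z w′~z′ w≁z′ w′≁z z≁z′
          ...   | no p≁w′  | _ = no-claw (~-sym p~w) w~w′ w~z
            (level-≢ lp lw′ (λ ())) (level-≢ lp lz (λ ())) (level-≢ lw′ lz (λ ()))
            p≁w′ (level-≁ lp lz ℕₚ.≤-refl) w′≁z

        Deep : V → Set
        Deep z = ∃ λ n → Level (2 + n) z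

        Inserted : V → V → List V → Set
        Inserted b a cs = ∃ λ cs′ → Arm u a cs′ × cs′ ↭ b ∷ cs

        -- Between the heights of its ends the arm meets b's level either in two
        -- consecutive vertices or in the middle of a monotone step, where the claw
        -- makes b adjacent to one of the outer two.
        insert-step : ∀ {a c d cs b l k} → a ~ c → c ~ d → Arm u d cs → All Deep (c ∷ cs) →
          Level (2 + l) b → Level (2 + k) a → l < k → b ∉ a ∷ c ∷ cs →
          (∀ {m} → Level (2 + m) c → l < m → Inserted b c (c ∷ cs)) →
          (∀ {m} → Level (2 + m) d → l < m → Inserted b d cs) → Inserted b a (a ∷ c ∷ cs)
        insert-step {a} {c} {d} {cs} {b} {l} {k} e f s ((m , lc) ∷ dcs) lb la l<k b∉ rec-c rec-d with ℕₚ.<-cmp m l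
        ... | tri< m<l _ _ = contradiction (level-step lc la (~-sym e)) (ℕₚ.<⇒≱ (s≤s (s≤s (ℕₚ.≤-<-trans m<l l<k))))
        ... | tri> _ _ l<m with rec-c lc l<m
        ...   | cs′ , r , perm = _ , e ∷ r , ↭-trans (prep a perm) (swap a b ↭-refl)
        insert-step {a} {c} {d} {cs} {b} {l} {k} e f s ((m , lc) ∷ dcs) lb la l<k b∉ rec-c rec-d | tri≈ _ refl _
          with a ~? b | b ~? d | clique l lc lb (λ { refl → b∉ (there (here refl)) })
        ... | yes a~b | _       | c~b = _ , a~b ∷ ~-sym c~b ∷ f ∷ s , swap a b ↭-refl
        ... | no _    | yes b~d | c~b = _ , e ∷ c~b ∷ b~d ∷ s , Permₚ.shift b (a ∷ c ∷ []) _
        ... | no a≁b  | no b≁d  | c~b = beyond s dcs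
          where
          no-claw-at-c : a ≢ d → b ≢ d → a ≁ d → ⊥
          no-claw-at-c a≢d b≢d a≁d = no-claw (~-sym e) c~b f (λ { refl → b∉ (here refl) }) a≢d b≢d a≁b a≁d b≁d
          beyond : Arm u d cs → All Deep cs → Inserted b a (a ∷ c ∷ cs)
          beyond nil _ = ⊥-elim (no-claw-at-c (level-≢ la lu (λ ())) (level-≢ lb lu (λ ()))
            (≁-sym (level-≁ lu la (s≤s (s≤s (ℕₚ.≤-trans (s≤s z≤n) l<k))))))
          beyond (_ ∷ _) ((j , ld) ∷ _) with ℕₚ.<-cmp j l
          ... | tri≈ _ refl _ = contradiction (clique l lb ld (λ { refl → b∉ (there (there (here refl))) })) b≁d
          ... | tri< j<l _ _ = ⊥-elim (no-claw-at-c
            (λ { refl → ℕₚ.<⇒≢ (ℕₚ.<-trans j<l l<k) (ℕₚ.suc-injective (ℕₚ.suc-injective (level-unique ld la))) })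
            (λ { refl → b∉ (there (there (here refl))) }) (≁-sym (level-≁ ld la (s≤s (s≤s (ℕₚ.≤-trans (s≤s j<l) l<k))))))
          ... | tri> _ _ l<j with rec-d ld l<j
          ...   | cs′ , s′ , perm = _ , e ∷ f ∷ s′ , ↭-trans (prep a (prep c perm)) (Permₚ.shift b (a ∷ c ∷ []) _)

        insert : ∀ {a cs} → Arm u a cs → All Deep cs → ∀ {b l k} → Level (2 + l) b → Level (2 + k) a →
                 l < k → b ∉ cs → Inserted b a cs
        insert nil _ _ la _ _ with level-unique la lu
        ... | ()
        insert (e ∷ nil) _ _ la l<k _ =
          contradiction (level-step lu la (~-sym e)) (ℕₚ.<⇒≱ (s≤s (s≤s (ℕₚ.≤-trans (s≤s z≤n) l<k))))
        insert (e ∷ r@(f ∷ r′)) (_ ∷ dcs@(_ ∷ dcs′)) lb la l<k b∉ = insert-step e f r′ dcs lb la l<k b∉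
          (λ lc l<m → insert r dcs lb lc l<m (b∉ ∘ there))
          (λ ld l<m → insert r′ dcs′ lb ld l<m (b∉ ∘ there ∘ there))

        Merged : V → V → List V → Set
        Merged a d zs = ∃ λ c → ∃ λ qs → Arm u c qs × (c ≡ a ⊎ c ≡ d) × qs ↭ zs

        -- The merged arm has the tip `d′` or `a`. In the first case `d` goes in front, and likewise
        -- in the second if it shares the level of `a`; a lower `d` is inserted further down.
        merge-higher : ∀ {a d d′ as ds k l} → d ~ d′ → Level (2 + k) a → Level (2 + l) d → l ≤ k →
                       All Deep (as ++ ds) → d ∉ as ++ ds → a ≢ d → Merged a d′ (as ++ ds) → Merged a d (as ++ d ∷ ds)
        merge-higher {d = d} {as = as} {ds} f la ld l≤k deep d∉ a≢d (c , qs , q , inj₂ refl , perm) =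
          d , d ∷ qs , f ∷ q , inj₂ refl , ↭-trans (prep d perm) (↭-sym (Permₚ.shift d as ds))
        merge-higher {a} {d} {as = as} {ds} {k} {l} f la ld l≤k deep d∉ a≢d (c , qs , q , inj₁ refl , perm)
          with ℕₚ.m≤n⇒m<n∨m≡n l≤k
        ... | inj₂ refl = d , d ∷ qs , clique l ld la (a≢d ∘ sym) ∷ q , inj₂ refl ,
          ↭-trans (prep d perm) (↭-sym (Permₚ.shift d as ds))
        ... | inj₁ l<k with insert q (Permₚ.All-resp-↭ (↭-sym perm) deep) ld la l<k (d∉ ∘ Permₚ.∈-resp-↭ perm)
        ...   | cs , q′ , perm′ = a , cs , q′ , inj₁ refl ,
          ↭-trans perm′ (↭-trans (prep d perm) (↭-sym (Permₚ.shift d as ds)))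

        -- The lower of the two tips is taken off, the rest is merged, and the tip is put back.
        merge : ∀ {a as d ds} → Arm u a as → Arm u d ds → All Deep as → All Deep ds → Unique (as ++ ds) →
                Merged a d (as ++ ds)
        merge nil s _ _ _ = _ , _ , s , inj₂ refl , ↭-refl
        merge r@(_ ∷ _) nil _ _ _ = _ , _ , r , inj₁ refl , ↭-sym (Permₚ.++-identityʳ _)
        merge {as = a∷as} {ds = d∷ds} r@(_∷_ {a} {bs = as} e r′) s@(_∷_ {d} {bs = ds} f s′) das@((k , la) ∷ das′) dds@((l , ld) ∷ dds′) us@(a∉ ∷ us″) =
          [ (λ l≤k → merge-higher {as = a∷as} f la ld l≤k (Allₚ.++⁺ das dds′) (Allₚ.All¬⇒¬Any d∉) a≢d (merge r s′ das dds′ us′))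
          , (λ k≤l → swapped (merge-higher {as = d∷ds} e ld la k≤l (Allₚ.++⁺ dds das′)
              (Allₚ.All¬⇒¬Any a∉ ∘ Permₚ.∈-resp-↭ (Permₚ.++-comm d∷ds as)) (a≢d ∘ sym)
              (swapped′ (merge r′ s das′ dds us″)))) ]′ (ℕₚ.≤-total l k)
          where
          moved = Unique-resp-↭ (Permₚ.shift d a∷as ds) us
          us′ : Unique (a∷as ++ ds)
          us′ with _ ∷ us′ ← moved = us′
          d∉ : All (d ≢_) (a∷as ++ ds)
          d∉ with d∉ ∷ _ ← moved = d∉
          a≢d : a ≢ d
          a≢d = All.lookup a∉ (∈-++⁺ʳ as (here refl))
          swapped : Merged d a (d∷ds ++ a∷as) → Merged a d (a∷as ++ d∷ds)
          swapped (c , qs , q , c≡ , perm) = c , qs , q , [ inj₂ , inj₁ ]′ c≡ , ↭-trans perm (Permₚ.++-comm d∷ds a∷as)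
          swapped′ : ∀ {b} → Merged b d (as ++ d∷ds) → Merged d b (d∷ds ++ as)
          swapped′ (c , qs , q , c≡ , perm) = c , qs , q , [ inj₂ , inj₁ ]′ c≡ , ↭-trans perm (Permₚ.++-comm as d∷ds)

        reached : ∀ {b bs} → Arm u b bs → All (_∈ S) bs → (∃ λ n → Ball n b) × All (λ z → ∃ λ n → Ball n z) bs
        reached nil _ = (1 , proj₁ lu) , []
        reached (e ∷ r) (b∈ ∷ bs∈) with reached r bs∈
        ... | (n , ball) , balls = here′ , here′ ∷ balls
          where here′ = suc n , inj₂ (there b∈ , _ , ball , ~-sym e)

        deep : All Deep (as ++ ds)
        deep = All.tabulate λ {z} z∈ → go (All.lookup balls z∈) z∈
          where
          balls : All (λ z → ∃ λ n → Ball n z) (as ++ ds)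
          balls = Allₚ.++⁺ (proj₂ (reached arm-a (All.tabulate (there ∘ ∈-++⁺ˡ))))
                           (proj₂ (reached arm-d (All.tabulate (there ∘ ∈-++⁺ʳ as))))
          go : ∀ {z} → (∃ λ n → Ball n z) → z ∈ as ++ ds → Deep z
          go (n , ball) z∈ with level n ball
          ... | zero , lz = contradiction (∈-xs (there z∈)) (subst (_∉ xs) (sym (level-0 lz)) (H∉ hx))
          ... | suc zero , lz = contradiction (subst (_∈ as ++ ds) (level-1 lz) z∈) (Uniqueₚ.Unique[x∷xs]⇒x∉xs unique-S)
          ... | suc (suc m) , lz = m , lz

        chain-⊥ : ⊥
        chain-⊥ with merge arm-a arm-d (Allₚ.++⁻ˡ as deep) (Allₚ.++⁻ʳ as deep) (Unique-++⁻ʳ [ u ] unique-S)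
        ... | c , qs , q , c≡ , perm = no-merge F q c≡ perm [] []

module ClawThetas (G : Graph) (claw-free : Free K13 G) where
  open ClawFree G claw-free public

  module Bypass {xs : List V} (closing : Closing xs) {x₀ y₀ : V} (x₀~y₀ : x₀ ~ y₀)
                (x₀∉ : x₀ ∉ xs) (y₀∉ : y₀ ∉ xs) (max : NoLonger (length xs)) where
    open Chain closing x₀~y₀ x₀∉ y₀∉ max public

    module _ (T : Theta) where
      open Theta T
      open Arcs T

      H-X : ∀ {z} → z ∈ X → H z
      H-X = All.lookup outside

      a~d′ : a ≁ x → d′ ≁ x → a ~ d′
      a~d′ a≁x d′≁x = decidable-stable (a ~? d′) λ a≁d′ → no-claw u~x u~a (~-sym d′~u)
        (H-≢ (H-X (head∈ path-x)) (∈A⇒∈xs (head∈ path-a))) (H-≢ (H-X (head∈ path-x)) (∈D⇒∈xs (last∈ path-d)))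
        (A#D (head∈ path-a) (last∈ path-d)) (≁-sym a≁x) (≁-sym d′≁x) a≁d′

      -- The successor `c` of `w` on A is adjacent neither to `a` nor to `d`, so `w` is the centre
      -- of a claw with leaves a, d, c.
      no-crossing : ∀ {w} → w ∈ A → w ~ a → w ~ d → w ~ d′ → ⊥
      no-crossing {w} w∈ w~a w~d w~d′ =
        no-claw w~a w~d w~c (A#D (head∈ path-a) (head∈ path-d)) (c≢a ∘ sym) (A#D c∈A (head∈ path-d) ∘ sym)
          a≁d (≁-sym (c≁a w~d)) (≁-sym (c≁d w~d′))
        where
        I = interior w∈ (~⇒≢ w~a) (λ { refl → a′≁d′ w~d′ })
        open Interior I using (w~c)
        open Split I

    adjacent-in-link : ∀ {u x a w} → u ~ x → u ~ a → u ~ w → H x → a ∈ xs → w ∈ xs → a ≁ x → w ≁ x → a ≢ w → w ~ a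
    adjacent-in-link {a = a} {w} u~x u~a u~w hx a∈ w∈ a≁x w≁x a≢w = decidable-stable (w ~? a) λ w≁a →
      no-claw u~x u~a u~w (H-≢ hx a∈) (H-≢ hx w∈) a≢w (≁-sym a≁x) (≁-sym w≁x) (≁-sym w≁a)

-- K₁,₃ and N₁,₁,₁

module NetCase (G : Graph) (tc : TwoConnected G) (claw-free : Free K13 G) (N111-free : Free N111 G) where
  open ClawFree G claw-free

  module _ {xs : List V} (closing : Closing xs) {x₀ y₀ : V} (x₀~y₀ : x₀ ~ y₀)
           (x₀∉ : x₀ ∉ xs) (y₀∉ : y₀ ∉ xs) (max : NoLonger (length xs)) where
    open Chain closing x₀~y₀ x₀∉ y₀∉ max

    no-frame : ¬ Frame
    no-frame F with Frame.att-u F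
    ... | x , hx , u~x = chain-⊥ F hx u~x
      λ lp₀ lp lw lw′ lz lz′ p₀~p p~w p~w′ w~w′ w~z w′~z′ w≁z′ w′≁z z≁z′ →
        N111-free (induced N111 (_ ∷ _ ∷ _ ∷ _ ∷ _ ∷ _ ∷ [])
          ( (p~w , p~w′ , ~-sym p₀~p , far lp lz ℕₚ.≤-refl , far lp lz′ ℕₚ.≤-refl)
          , (w~w′ , ≁-sym (far lp₀ lw ℕₚ.≤-refl) , w~z , w≁z′)
          , (≁-sym (far lp₀ lw′ ℕₚ.≤-refl) , w′≁z , w′~z′)
          , (far lp₀ lz (ℕₚ.n≤1+n _) , far lp₀ lz′ (ℕₚ.n≤1+n _)) , z≁z′))
      where
      far : ∀ {m n w z} → Level F hx u~x m w → Level F hx u~x n z → suc m < n → w ≁ z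
      far = level-≁ F hx u~x

  not-extremal : ¬ Extremal
  not-extremal (_ , c , l , max , _ , _ , _ , e , x∉ , y∉) =
    Component.framed c e x∉ y∉ max tc l (λ _ → no-frame c e x∉ y∉ max)

-- K₁,₃ and B₁,₂

module BullCase (G : Graph) (tc : TwoConnected G) (claw-free : Free K13 G) (B12-free : Free B12 G) where
  open ClawThetas G claw-free

  module _ {xs : List V} (closing : Closing xs) {x₀ y₀ : V} (x₀~y₀ : x₀ ~ y₀)
           (x₀∉ : x₀ ∉ xs) (y₀∉ : y₀ ∉ xs) (max : NoLonger (length xs)) where
    open Bypass closing x₀~y₀ x₀∉ y₀∉ max

    no-B12 : ∀ {w p w′ z q r} → w ~ p → p ~ w′ → w ~ w′ → w ~ z → p ~ q → q ~ r →
             w ≁ q → w ≁ r → p ≁ z → p ≁ r → w′ ≁ z → w′ ≁ q → w′ ≁ r → z ≁ q → z ≁ r → ⊥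
    no-B12 wp pw′ ww′ wz pq qr w≁q w≁r p≁z p≁r w′≁z w′≁q w′≁r z≁q z≁r =
      B12-free (induced B12 (_ ∷ _ ∷ _ ∷ _ ∷ _ ∷ _ ∷ [])
        ((wp , ww′ , wz , w≁q , w≁r) , (pw′ , p≁z , pq , p≁r) , (w′≁z , w′≁q , w′≁r) , (z≁q , z≁r) , qr))

    -- Since w ≁ x, claw-freeness at `u` and `v` makes `w` adjacent to `a`, `d` and `d′`, against
    -- `no-crossing`.
    common-in-A : ∀ T → Theta.y T ≡ Theta.x T → ∀ {w} → w ∈ Theta.A T → Theta.u T ~ w → Theta.v T ~ w → w ≁ Theta.x T → ⊥
    common-in-A T refl {w} w∈ u~w v~w w≁x = no-crossing T w∈
      (link u~x u~a u~w (∈A⇒∈xs (head∈ path-a)) (∈A⇒∈xs w∈) (≁-sym y≁a) w≁x λ { refl → a≁v edge-u edge-v (~-sym v~w) })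
      (link (~-sym y~v) v~d v~w (∈D⇒∈xs (head∈ path-d)) (∈A⇒∈xs w∈) (≁-sym x≁d) w≁x (A#D w∈ (head∈ path-d) ∘ sym))
      (link u~x (~-sym d′~u) u~w (∈D⇒∈xs (last∈ path-d)) (∈A⇒∈xs w∈) (≁-sym y≁d′) w≁x (A#D w∈ (last∈ path-d) ∘ sym))
      where
      open Theta T
      open Arcs T
      hx = H-X T (head∈ path-x)
      link : ∀ {u a w} → u ~ _ → u ~ a → u ~ w → a ∈ xs → w ∈ xs → a ≁ _ → w ≁ _ → a ≢ w → w ~ a
      link e f g = adjacent-in-link e f g hx
      edge-u = a~d′ T (≁-sym y≁a) (≁-sym y≁d′)
      edge-v : a′ ~ d
      edge-v = a~d′ (mirror T) (≁-sym x≁a′) (≁-sym x≁d)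

    no-common : ∀ {u v x w} → u ∈ xs → v ∈ xs → u ≢ v → H x → u ~ x → v ~ x → w ∈ xs → u ~ w → v ~ w → w ≁ x → ⊥
    no-common u∈ v∈ u≢v hx u~x v~x w∈ u~w v~w w≁x with theta u∈ v∈ u≢v (chord end (hx ∷ []) ([] ∷ []) u~x (~-sym v~x))
    ... | T , refl , refl , refl , refl with ∈-++⁻ (Theta.A T) (Permₚ.∈-resp-↭ (↭-sym (Theta.cover T)) w∈)
    ...   | inj₁ w∈A = common-in-A T refl w∈A u~w v~w w≁x
    ...   | inj₂ w∈′ with ∈-++⁻ (Theta.D T) w∈′
    ...     | inj₁ w∈D = common-in-A (swap-arcs T) refl (Permₚ.∈-resp-↭ (↭-sym (Permₚ.↭-reverse _)) w∈D) u~w v~w w≁x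
    ...     | inj₂ (here refl) = ≁-refl u~w
    ...     | inj₂ (there (here refl)) = ≁-refl v~w

    -- Either alternative prolongs u, x by a further vertex. It replaces the missing level below `x`
    -- when the long arm of `B12` is needed there.
    Anchor : V → V → Set
    Anchor u x = H x × u ~ x × ((∃ λ t → H t × x ~ t × t ≁ u) ⊎ (∃ λ v → v ∈ xs × v ≢ u × v ~ x))

    -- Walk in `H` towards a neighbour of `v`, moving on as long as the next vertex is adjacent to
    -- `u`.
    anchor : ∀ {u v} → Attached u → Attached v → v ∈ xs → v ≢ u → ∃ (Anchor u)
    anchor {u} {v} (h , hh , u~h) (h′ , hh′ , v~h′) v∈ v≢u = go (H-walk hh (walk-append (walk-reverse hh) hh′)) u~h v~h′
      where
      go : ∀ {h h′} → Walk G H h h′ → u ~ h → v ~ h′ → ∃ (Anchor u)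
      go {h} (here hh) u~h v~h = h , hh , u~h , inj₂ (v , v∈ , v≢u , v~h)
      go {h} (step {y = t} hh h~t r) u~h v~h′ with u ~? t
      ... | yes u~t = go r u~t v~h′
      ... | no  u≁t = h , hh , u~h , inj₁ (t , walk-start r , h~t , ≁-sym u≁t)

    no-frame : ¬ Frame
    no-frame F = chain-⊥ F hx u~x no-net
      where
      open Frame F
      u∈xs : u ∈ xs
      u∈xs = Permₚ.∈-resp-↭ cover (here refl)
      v∈rest : v ∈ as ++ ds ++ rs
      v∈rest = ∈-++⁺ʳ as (∈-++⁺ʳ ds (last∈ back))
      v∈xs : v ∈ xs
      v∈xs = Permₚ.∈-resp-↭ cover (there v∈rest)
      anchored = anchor att-u att-v v∈xs λ { refl →
        Uniqueₚ.Unique[x∷xs]⇒x∉xs (Unique-resp-↭ (↭-sym cover) unique-xs) v∈rest }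
      x = proj₁ anchored
      hx = proj₁ (proj₂ anchored)
      u~x = proj₁ (proj₂ (proj₂ anchored))

      L : ℕ → V → Set
      L = Level F hx u~x
      far : ∀ {m n w z} → L m w → L n z → suc m < n → w ≁ z
      far = level-≁ F hx u~x
      off : ∀ {n z h} → L (2 + n) z → H h → z ≁ h
      off lz hh e with ∈-++⁻ as (level-body F hx u~x lz)
      ... | inj₁ z∈ = All.lookup free-a z∈ (_ , hh , e)
      ... | inj₂ z∈ = All.lookup free-d z∈ (_ , hh , e)
      on-cycle : ∀ {n z} → L (2 + n) z → z ∈ xs
      on-cycle lz = ∈-xs F hx u~x (there (level-body F hx u~x lz))

      u≁ : ∀ {z} → L 3 z → u ≁ z
      u≁ lz = far (lu F hx u~x) lz ℕₚ.≤-refl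
      differ : ∀ {a b c} → a ~ c → b ≁ c → a ≢ b
      differ e n refl = n e

      module _ {v₀ : V} (v₀∈ : v₀ ∈ xs) (v₀≢u : v₀ ≢ u) (v₀~x : v₀ ~ x) where

        w≁v₀ : ∀ {w} → L 2 w → u ~ w → w ≁ v₀
        w≁v₀ lw u~w e = no-common u∈xs v₀∈ (v₀≢u ∘ sym) hx u~x v₀~x (on-cycle lw) u~w (~-sym e) (off lw hx)

        module _ {w w′ z : V} (lw : L 2 w) (lw′ : L 2 w′) (lz : L 3 z) (u~w : u ~ w) (u~w′ : u ~ w′)
                 (w~w′ : w ~ w′) (w~z : w ~ z) (w′≁z : w′ ≁ z) where

          z~v₀ : u ≁ v₀ → z ~ v₀
          z~v₀ u≁v₀ = decidable-stable (z ~? v₀) λ z≁v₀ →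
            no-B12 (~-sym u~w) u~w′ w~w′ w~z u~x (~-sym v₀~x)
              (off lw hx) (w≁v₀ lw u~w) (u≁ lz) u≁v₀ w′≁z (off lw′ hx) (w≁v₀ lw′ u~w′) (off lz hx) z≁v₀

          -- If f ≁ z, then f ~ w gives a claw at `w`, and f ≁ w gives a `B12` on the triangle v₀,
          -- u, x.
          f~z : u ~ v₀ → z ≁ v₀ → ∀ {f} → f ~ v₀ → f ≁ x → f ≁ u → f ~ z
          f~z u~v₀ z≁v₀ {f} f~v₀ f≁x f≁u = decidable-stable (f ~? z) λ f≁z → case-⊥ {f ~ w}
            (λ f~w → no-claw (~-sym u~w) w~z (~-sym f~w) (differ u~x (off lz hx)) (differ u~x f≁x)
              (differ f~v₀ z≁v₀ ∘ sym) (u≁ lz) (≁-sym f≁u) (≁-sym f≁z))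
            (λ f≁w → no-B12 (~-sym u~v₀) u~x v₀~x (~-sym f~v₀) u~w w~z
              (≁-sym (w≁v₀ lw u~w)) (≁-sym z≁v₀) (≁-sym f≁u) (u≁ lz) (≁-sym f≁x) (≁-sym (off lw hx)) (≁-sym (off lz hx)) f≁w f≁z)

        outer : ∃ λ f → f ~ v₀ × f ≁ x × f ≁ u
        outer with theta u∈xs v₀∈ (v₀≢u ∘ sym) (chord end (hx ∷ []) ([] ∷ []) u~x (~-sym v₀~x))
        ... | T , refl , refl , refl , refl = Theta.d T , ~-sym (Theta.v~d T) , ≁-sym (Arcs.x≁d T) ,
          Arcs.d≁u T (a~d′ T (≁-sym (Arcs.y≁a T)) (≁-sym (Arcs.y≁d′ T)))
                     (a~d′ (mirror T) (≁-sym (Arcs.x≁a′ T)) (≁-sym (Arcs.x≁d T)))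

        -- If `z` and `z′` both see `v₀`, there is a claw at `v₀`; if both miss it, both see `f` and
        -- there is a claw at `f`. If just one sees `v₀`, it can play the part of `f` and is
        -- adjacent to the other.
        no-fork : ∀ {w w′ z z′} → L 2 w → L 2 w′ → L 3 z → L 3 z′ → u ~ w → u ~ w′ → w ~ w′ → w ~ z → w′ ~ z′ →
                  w ≁ z′ → w′ ≁ z → z ≁ z′ → ⊥
        no-fork {w} {w′} {z} {z′} lw lw′ lz lz′ u~w u~w′ w~w′ w~z w′~z′ w≁z′ w′≁z z≁z′ =
          case-⊥ {u ~ v₀} joined λ u≁v₀ →
            both (z~v₀ lw lw′ lz u~w u~w′ w~w′ w~z w′≁z u≁v₀) (z~v₀ lw′ lw lz′ u~w′ u~w (~-sym w~w′) w′~z′ w≁z′ u≁v₀)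
          where
          z≢z′ : z ≢ z′
          z≢z′ = differ (~-sym w~z) (≁-sym w≁z′)
          both : z ~ v₀ → z′ ~ v₀ → ⊥
          both e e′ = no-claw v₀~x (~-sym e) (~-sym e′) (H-≢ hx (on-cycle lz)) (H-≢ hx (on-cycle lz′)) z≢z′
            (≁-sym (off lz hx)) (≁-sym (off lz′ hx)) z≁z′
          joined : u ~ v₀ → ⊥
          joined u~v₀ with z ~? v₀ | z′ ~? v₀ | outer
          ... | yes e | yes e′ | _ = both e e′
          ... | yes e | no n′  | _ =
            z≁z′ (f~z lw′ lw lz′ u~w′ u~w (~-sym w~w′) w′~z′ w≁z′ u~v₀ n′ e (off lz hx) (≁-sym (u≁ lz)))
          ... | no n  | yes e′ | _ =
            z≁z′ (~-sym (f~z lw lw′ lz u~w u~w′ w~w′ w~z w′≁z u~v₀ n e′ (off lz′ hx) (≁-sym (u≁ lz′))))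
          ... | no n  | no n′  | f , f~v₀ , f≁x , f≁u = no-claw f~v₀
            (f~z lw lw′ lz u~w u~w′ w~w′ w~z w′≁z u~v₀ n f~v₀ f≁x f≁u)
            (f~z lw′ lw lz′ u~w′ u~w (~-sym w~w′) w′~z′ w≁z′ u~v₀ n′ f~v₀ f≁x f≁u)
            (differ v₀~x (off lz hx)) (differ v₀~x (off lz′ hx)) z≢z′ (≁-sym n) (≁-sym n′) z≁z′

      no-net : Net F hx u~x
      -- Below `p` there are still two levels, and p₀, p₁ form the long arm of `B12`.
      no-net {suc n} lp₀ lp lw lw′ lz lz′ p₀~p p~w p~w′ w~w′ w~z w′~z′ w≁z′ w′≁z z≁z′ with parent F hx u~x n lp₀
      ... | p₁ , lp₁ , p₁~p₀ = no-B12 (~-sym p~w) p~w′ w~w′ w~z (~-sym p₀~p) (~-sym p₁~p₀)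
        (≁-sym (far lp₀ lw ℕₚ.≤-refl)) (≁-sym (far lp₁ lw (ℕₚ.n≤1+n _))) (far lp lz ℕₚ.≤-refl)
        (≁-sym (far lp₁ lp ℕₚ.≤-refl)) w′≁z (≁-sym (far lp₀ lw′ ℕₚ.≤-refl)) (≁-sym (far lp₁ lw′ (ℕₚ.n≤1+n _)))
        (≁-sym (far lp₀ lz (ℕₚ.n≤1+n _))) (≁-sym (far lp₁ lz (ℕₚ.m≤n+m _ 2)))
      no-net {zero} lp₀ lp lw lw′ lz lz′ p₀~p p~w p~w′ w~w′ w~z w′~z′ w≁z′ w′≁z z≁z′
        with level-1 F hx u~x lp | proj₂ (proj₂ (proj₂ anchored))
      ... | refl | inj₁ (t , ht , x~t , t≁u) = no-B12 (~-sym p~w) p~w′ w~w′ w~z u~x x~t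
        (off lw hx) (off lw ht) (far lp lz ℕₚ.≤-refl) (≁-sym t≁u) w′≁z (off lw′ hx) (off lw′ ht) (off lz hx) (off lz ht)
      ... | refl | inj₂ (v₀ , v₀∈ , v₀≢u , v₀~x) =
        no-fork v₀∈ v₀≢u v₀~x lw lw′ lz lz′ p~w p~w′ w~w′ w~z w′~z′ w≁z′ w′≁z z≁z′

  not-extremal : ¬ Extremal
  not-extremal (_ , c , l , max , _ , _ , _ , e , x∉ , y∉) =
    Component.framed c e x∉ y∉ max tc l (λ _ → no-frame c e x∉ y∉ max)

-- K₁,₃** and Z₁

module LayeredArms (G : Graph) where
  open Components G

  -- Levels are counted from a vertex two steps behind u.
  module Bands {u : V} {Body : V → Set} (Level : ℕ → V → Set) (lu : Level 2 u)
               (level-unique : ∀ {m n z} → Level m z → Level n z → m ≡ n)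
               (level-step : ∀ {m n w z} → Level m w → Level n z → w ~ z → n ≤ suc m)
               (complete : ∀ n {w z} → Level n w → Level (suc n) z → w ~ z)
               (independent : ∀ n {z z′} → Level n z → Level n z′ → z ≁ z′)
               (grow : ∀ {n w z} → Level (2 + n) w → w ~ z → Body z → ∃ λ m → Level (3 + m) z) where

    -- Adjacency of two vertices depends only on their levels.
    twin : ∀ {m n w c s} → Level n w → Level n c → Level m s → w ~ s → c ~ s
    twin {m} {n} lw lc ls w~s with ℕₚ.<-cmp m n
    ... | tri≈ _ refl _ = contradiction w~s (independent m lw ls)
    ... | tri< m<n _ _ with ℕₚ.≤-antisym m<n (level-step ls lw (~-sym w~s))
    ...   | refl = ~-sym (complete m ls lc)
    twin {m} {n} lw lc ls w~s | tri> _ _ n<m with ℕₚ.≤-antisym n<m (level-step lw ls w~s)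
    ...   | refl = complete n lc ls

    Deep : V → Set
    Deep z = ∃ λ n → Level (3 + n) z

    arm-tip : ∀ {b bs} → Arm u b bs → All Deep bs → ∃ λ n → Level (2 + n) b
    arm-tip nil     _              = 0 , lu
    arm-tip (_ ∷ _) ((n , lb) ∷ _) = suc n , lb

    insert-pair : ∀ {b bs} → Arm u b bs → All Deep bs → ∀ {w n c d m} → w ∈ bs → Level n w → Level n c → Level m d →
                  c ~ d → ∃ λ bs′ → Arm u b bs′ × bs′ ↭ c ∷ d ∷ bs
    insert-pair {bs = b ∷ bs} (e ∷ r) (_ ∷ dbs) {c = c} {d} (here refl) lw lc ld c~d =
      _ , twin lc lw ld c~d ∷ ~-sym c~d ∷ twin lw lc (proj₂ (arm-tip r dbs)) e ∷ r ,
      ↭-trans (prep b (swap d c ↭-refl)) (↭-sym (Permₚ.shift b (c ∷ d ∷ []) bs))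
    insert-pair {bs = b ∷ bs} (e ∷ r) (_ ∷ dbs) {c = c} {d} (there w∈) lw lc ld c~d with insert-pair r dbs w∈ lw lc ld c~d
    ... | bs′ , r′ , perm = _ , e ∷ r′ , ↭-trans (prep b perm) (↭-sym (Permₚ.shift b (c ∷ d ∷ []) bs))

    Below : List V → List V → Set
    Below as bs = ∀ {z n} → z ∈ as → Level (3 + n) z → ∃ λ w → w ∈ bs × Level (3 + n) w

    Absorbed : V → List V → List V → Set
    Absorbed b as bs = ∃ λ cs → Arm u b cs × cs ↭ as ++ bs

    -- Pairs are formed from the end at `u`, so a vertex left over is the tip of the guest.
    absorb : ∀ {a as b bs} → Arm u a as → All Deep as → Arm u b bs → All Deep bs → Below as bs →
             Absorbed b as bs ⊎ ∃ λ as′ → as ≡ a ∷ as′ × Absorbed b as′ bs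
    absorb nil _ s _ _ = inj₁ (_ , s , ↭-refl)
    absorb {bs = bs} (_∷_ {a} {bs = as} e r) ((n , la) ∷ das) s dbs below with absorb r das s dbs (below ∘ there)
    ... | inj₁ absorbed = inj₂ (_ , refl , absorbed)
    ... | inj₂ (as′ , refl , cs , q , perm) with below (here refl) la
    ...   | w , w∈ , lw with insert-pair q (Permₚ.All-resp-↭ (↭-sym perm) (Allₚ.++⁺ (All.tail das) dbs))
                             (Permₚ.∈-resp-↭ (↭-sym perm) (∈-++⁺ʳ as′ w∈)) lw la (proj₂ (All.head das)) e
    ...     | cs′ , q′ , perm′ = inj₁ (cs′ , q′ , ↭-trans perm′ (prep a (prep _ perm)))

    -- An edge lowers the level by at most one, so the way to `u` meets every level in between.
    descend : ∀ {b bs n m} → Arm u b bs → All Deep bs → Level (3 + n) b → m ≤ n → ∃ λ w → w ∈ bs × Level (3 + m) w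
    descend nil _ lb _ with level-unique lb lu
    ... | ()
    descend {b} {n = n} {m} (e ∷ r) (_ ∷ dbs) lb m≤n with ℕₚ.m≤n⇒m<n∨m≡n m≤n
    ... | inj₂ refl = b , here refl , lb
    descend {b} {n = n} {m} (e ∷ nil) (_ ∷ dbs) lb m≤n | inj₁ m<n =
      contradiction (level-step lu lb (~-sym e)) (ℕₚ.<⇒≱ (s≤s (s≤s (s≤s (ℕₚ.≤-trans (s≤s z≤n) m<n)))))
    descend {b} {n = n} {m} (e ∷ r@(_ ∷ _)) (_ ∷ dbs@((k , lc) ∷ _)) lb m≤n | inj₁ m<n
      with descend r dbs lc (ℕₚ.≤-pred (ℕₚ.≤-trans m<n (ℕₚ.≤-pred (ℕₚ.≤-pred (ℕₚ.≤-pred (level-step lc lb (~-sym e)))))))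
    ... | w , w∈ , lw = w , there w∈ , lw

    descend-from : ∀ {b bs z n m} → Arm u b bs → All Deep bs → z ∈ bs → Level (3 + n) z → m ≤ n →
                   ∃ λ w → w ∈ bs × Level (3 + m) w
    descend-from r@(_ ∷ _) dbs (here refl) lz m≤n = descend r dbs lz m≤n
    descend-from (_ ∷ r) (_ ∷ dbs) (there z∈) lz m≤n with descend-from r dbs z∈ lz m≤n
    ... | w , w∈ , lw = w , there w∈ , lw

    top : ∀ {b bs} → All Deep (b ∷ bs) → ∃ λ z → ∃ λ n → z ∈ b ∷ bs × Level (3 + n) z ×
          (∀ {w m} → w ∈ b ∷ bs → Level (3 + m) w → m ≤ n)
    top {bs = []} ((n , lb) ∷ []) = _ , n , here refl , lb , λ { (here refl) lw → ℕₚ.≤-reflexive (same lw lb) }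
      where same : ∀ {m n z} → Level (3 + m) z → Level (3 + n) z → m ≡ n
            same l l′ = ℕₚ.+-cancelˡ-≡ 3 _ _ (level-unique l l′)
    top {bs = c ∷ bs} ((k , lb) ∷ dbs) with top dbs
    ... | z , n , z∈ , lz , bound with ℕₚ.≤-total k n
    ...   | inj₁ k≤n = z , n , there z∈ , lz , λ
      { (here refl) lw → ℕₚ.≤-trans (ℕₚ.≤-reflexive (ℕₚ.+-cancelˡ-≡ 3 _ _ (level-unique lw lb))) k≤n
      ; (there w∈) lw → bound w∈ lw }
    ...   | inj₂ n≤k = _ , k , here refl , lb , λ
      { (here refl) lw → ℕₚ.≤-reflexive (ℕₚ.+-cancelˡ-≡ 3 _ _ (level-unique lw lb))
      ; (there w∈) lw → ℕₚ.≤-trans (bound w∈ lw) n≤k }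

    comparable : ∀ {a as b bs} → Arm u a as → All Deep as → Arm u b bs → All Deep bs → Below as bs ⊎ Below bs as
    comparable nil _ _ _ = inj₁ λ ()
    comparable (_ ∷ _) _ nil _ = inj₂ λ ()
    comparable r@(_ ∷ _) das s@(_ ∷ _) dbs with top das | top dbs
    ... | z , m , z∈ , lz , above | w , n , w∈ , lw , above′ with ℕₚ.≤-total m n
    ...   | inj₁ m≤n = inj₁ λ t∈ lt → descend-from s dbs w∈ lw (ℕₚ.≤-trans (above t∈ lt) m≤n)
    ...   | inj₂ n≤m = inj₂ λ t∈ lt → descend-from r das z∈ lz (ℕₚ.≤-trans (above′ t∈ lt) n≤m)

    deepen : ∀ {b bs} → Arm u b bs → All Body bs → All Deep bs
    deepen nil     _        = []
    deepen (e ∷ r) (b ∷ bs) with deepen r bs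
    ... | dbs = grow (proj₂ (arm-tip r dbs)) (~-sym e) b ∷ dbs

module PawCase (G : Graph) (tc : TwoConnected G) (spider-free : Free K13ss G) (paw-free : Free Z1 G) where
  open Levels G
  open LayeredArms G

  no-paw : ∀ {a b c d} → a ~ b → b ~ c → a ~ c → a ~ d → b ≁ d → c ≁ d → ⊥
  no-paw ab bc ac ad b≁d c≁d = paw-free (induced Z1 (_ ∷ _ ∷ _ ∷ _ ∷ []) ((ab , ac , ad) , (bc , b≁d) , c≁d))

  module _ {xs : List V} (closing : Closing xs) {x₀ y₀ : V} (x₀~y₀ : x₀ ~ y₀)
           (x₀∉ : x₀ ∉ xs) (y₀∉ : y₀ ∉ xs) (max : NoLonger (length xs))
           (better : ∀ {ys} → Closing ys → length ys ≡ length xs → exposure ys < exposure xs → ⊥) where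
    open Component closing x₀~y₀ x₀∉ y₀∉ max

    Body : V → Set
    Body z = ¬ H z × ¬ Attached z

    module Layers (H? : ∀ z → Dec (H z)) {u x y : V} (u∈ : u ∈ xs) (hx : H x) (hy : H y)
                  (x~y : x ~ y) (u~x : u ~ x) (u≁y : u ≁ y) where

      U : V → Set
      U z = z ≡ y ⊎ z ≡ x ⊎ z ≡ u ⊎ Body z

      U? : ∀ z → Dec (U z)
      U? z = (z ≟ y) ⊎-dec (z ≟ x) ⊎-dec (z ≟ u) ⊎-dec (¬? (H? z) ×-dec ¬? (any? λ h → H? h ×-dec (z ~? h)))

      open Search U? {y} (inj₁ refl) public

      level-1 : ∀ {z} → Level 1 z → z ≡ x
      level-1 lz with level-U 1 lz | parent 0 lz
      ... | inj₁ refl                  | _ , (refl , _) , e = contradiction e ≁-refl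
      ... | inj₂ (inj₁ z≡x)            | _                  = z≡x
      ... | inj₂ (inj₂ (inj₁ refl))    | _ , (refl , _) , e = contradiction (~-sym e) u≁y
      ... | inj₂ (inj₂ (inj₂ (_ , ¬a))) | _ , (refl , _) , e = contradiction (_ , hy , ~-sym e) ¬a

      level-2 : ∀ {z} → Level 2 z → z ≡ u
      level-2 lz with level-U 2 lz | parent 1 lz
      ... | inj₁ refl                  | _ = contradiction refl (proj₂ lz {0} (s≤s z≤n))
      ... | inj₂ (inj₂ (inj₁ z≡u))     | _ = z≡u
      ... | inj₂ (inj₁ refl)           | w , lw , e with level-1 lw
      ...   | refl = contradiction e ≁-refl
      level-2 lz | inj₂ (inj₂ (inj₂ (_ , ¬a))) | w , lw , e with level-1 lw
      ...   | refl = contradiction (_ , hx , ~-sym e) ¬a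

      ball-x : Ball 1 x
      ball-x = inj₂ (inj₂ (inj₁ refl) , y , refl , ~-sym x~y)

      ball-u : Ball 2 u
      ball-u = inj₂ (inj₂ (inj₂ (inj₁ refl)) , x , ball-x , ~-sym u~x)

      lu : Level 2 u
      lu = ball-u , λ { {zero} _ refl → H∉ hy u∈
                      ; {suc zero} _ (inj₁ refl) → H∉ hy u∈
                      ; {suc zero} _ (inj₂ (_ , _ , refl , e)) → u≁y (~-sym e)
                      ; {suc (suc _)} (s≤s (s≤s ())) _ }

      level-body : ∀ {n z} → Level (3 + n) z → Body z
      level-body {n} lz with level-U (3 + n) lz
      ... | inj₁ refl               = contradiction refl (proj₂ lz {0} (s≤s z≤n))
      ... | inj₂ (inj₁ refl)        = contradiction ball-x (proj₂ lz {1} (s≤s (s≤s z≤n)))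
      ... | inj₂ (inj₂ (inj₁ refl)) = contradiction ball-u (proj₂ lz {2} (s≤s (s≤s (s≤s z≤n))))
      ... | inj₂ (inj₂ (inj₂ b))    = b

      Complete : ℕ → Set
      Complete n = ∀ {w z} → Level n w → Level (suc n) z → w ~ z

      -- By completeness an edge inside a level and a parent form a triangle, which becomes a paw
      -- with a vertex one level further down.
      independent-above : ∀ n → Complete n → ∀ {z z′} → Level (suc n) z → Level (suc n) z′ → z ≁ z′
      independent-above 0 _ lz lz′ e with level-1 lz | level-1 lz′
      ... | refl | refl = ≁-refl e
      independent-above (suc n) complete-n lz lz′ e with parent (suc n) lz
      ... | w , lw , w~z with parent n lw
      ...   | w₀ , lw₀ , w₀~w = no-paw w~z e (complete-n lw lz′) (~-sym w₀~w)
        (≁-sym (level-≁ lw₀ lz ℕₚ.≤-refl)) (≁-sym (level-≁ lw₀ lz′ ℕₚ.≤-refl))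

      -- Were d′ ≁ f, then z₀ would be the centre of an induced `K13ss` with arms w w₂, d f and d′.
      -- The arm w w₂ reaches two levels below z₀, which is why levels start two steps behind `u`.
      complete-above : ∀ k → Complete (2 + k) → Complete (3 + k)
      complete-above k complete-k {d′} {f} ld′ lf = decidable-stable (d′ ~? f) λ d′≁f →
        let d , ld , d~f    = parent (3 + k) lf
            z₀ , lz₀ , z₀~d = parent (2 + k) ld
            w , lw , w~z₀   = parent (1 + k) lz₀
            w₂ , lw₂ , w₂~w = parent k lw
        in spider-free (induced K13ss (z₀ ∷ w ∷ d ∷ d′ ∷ w₂ ∷ f ∷ [])
          ( (~-sym w~z₀ , z₀~d , complete-k lz₀ ld′ , ≁-sym (level-≁ lw₂ lz₀ ℕₚ.≤-refl) , level-≁ lz₀ lf ℕₚ.≤-refl)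
          , (level-≁ lw ld ℕₚ.≤-refl , level-≁ lw ld′ ℕₚ.≤-refl , ~-sym w₂~w , level-≁ lw lf (ℕₚ.n≤1+n _))
          , (independent-above (2 + k) complete-k ld ld′ , ≁-sym (level-≁ lw₂ ld (ℕₚ.n≤1+n _)) , d~f)
          , (≁-sym (level-≁ lw₂ ld′ (ℕₚ.n≤1+n _)) , d′≁f)
          , level-≁ lw₂ lf (ℕₚ.m≤n+m _ 2)))

      complete : ∀ n → Complete n
      complete 0 (refl , _) lz with level-1 lz
      ... | refl = ~-sym x~y
      complete 1 lw lz with level-1 lw | level-2 lz
      ... | refl | refl = ~-sym u~x
      complete 2 lw lz with parent 2 lz
      ... | w′ , lw′ , e with level-2 lw | level-2 lw′
      ...   | refl | refl = e
      complete (suc n@(suc (suc k))) = complete-above k (complete n)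

      independent : ∀ n {z z′} → Level n z → Level n z′ → z ≁ z′
      independent zero    (refl , _) (refl , _) = ≁-refl
      independent (suc n) = independent-above n (complete n)

      grow : Attached u → ∀ {n w z} → Level (2 + n) w → w ~ z → Body z → ∃ λ m → Level (3 + m) z
      grow att-u {n} {w} lw w~z (¬hz , ¬az) with level (3 + n) (inj₂ (inj₂ (inj₂ (inj₂ (¬hz , ¬az))) , w , proj₁ lw , w~z))
      ... | 0 , (refl , _)         = contradiction hy ¬hz
      ... | 1 , lz                 = contradiction (subst H (sym (level-1 lz)) hx) ¬hz
      ... | 2 , lz                 = contradiction (subst Attached (sym (level-2 lz)) att-u) ¬az
      ... | suc (suc (suc m)) , lz = m , lz

    on-cycle : ∀ F {z} → z ∈ Frame.u F ∷ Frame.as F ++ Frame.ds F → z ∈ xs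
    on-cycle F z∈ = Permₚ.∈-resp-↭ (↭-trans (↭-reflexive (cong (u ∷_) (Listₚ.++-assoc as ds rs))) cover) (∈-++⁺ˡ z∈)
      where open Frame F

    body : ∀ {z} → z ∈ xs → ¬ Attached z → Body z
    body z∈ ¬az = (λ hz → H∉ hz z∈) , ¬az

    module Finish (F : Frame) (Level : ℕ → V → Set) (lu : Level 2 (Frame.u F))
             (level-unique : ∀ {m n z} → Level m z → Level n z → m ≡ n)
             (level-step : ∀ {m n w z} → Level m w → Level n z → w ~ z → n ≤ suc m)
             (complete : ∀ n {w z} → Level n w → Level (suc n) z → w ~ z)
             (independent : ∀ n {z z′} → Level n z → Level n z′ → z ≁ z′)
             (grow : ∀ {n w z} → Level (2 + n) w → w ~ z → Body z → ∃ λ m → Level (3 + m) z) where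
      open Frame F
      open Bands Level lu level-unique level-step complete independent grow

      body-ad : All Body (as ++ ds)
      body-ad = All.tabulate λ z∈ → body (on-cycle F (there z∈)) (All.lookup (Allₚ.++⁺ free-a free-d) z∈)

      -- The host arm absorbs the guest in consecutive pairs; at worst the tip m of the guest is left over.
      host : ∀ {m ms b bs} → Arm u m ms → Arm u b bs → b ≡ a ⊎ b ≡ d → ms ++ bs ↭ as ++ ds →
             All Deep ms → All Deep bs → Below ms bs → ⊥
      host {bs = bs} r s b≡ perm dms dbs below with absorb r dms s dbs below
      ... | inj₁ (cs , q , perm′) = no-merge F q b≡ (↭-trans perm′ perm) [] []
      host {m} {bs = bs} r s b≡ perm dms@((n , lm) ∷ dms′) dbs below | inj₂ (ms , refl , cs , q , perm′)
        with reroute F {ls = m ∷ []} q b≡ cs-m [] []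
        where
        cs-m : cs ++ m ∷ [] ↭ as ++ ds
        cs-m = ↭-trans (↭-sym (Permₚ.∷↭∷ʳ m cs)) (↭-trans (prep m perm′) perm)
      ... | zs , h , hs , closing′@(_ , _ , p , e , us) , hh , all↭ = shorter hs all↭
        where
        m∈xs : m ∈ xs
        m∈xs = on-cycle F (there (Permₚ.∈-resp-↭ perm (here refl)))
        count : ∀ hs → zs ++ m ∷ [] ↭ xs ++ h ∷ hs → length zs ≡ length xs + length hs
        count hs all↭ = ℕₚ.suc-injective (begin
          suc (length zs)              ≡⟨ ℕₚ.+-comm 1 (length zs) ⟩
          length zs + 1                ≡⟨ Listₚ.length-++ zs ⟨
          length (zs ++ m ∷ [])        ≡⟨ Permₚ.↭-length all↭ ⟩
          length (xs ++ h ∷ hs)        ≡⟨ Listₚ.length-++ xs ⟩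
          length xs + suc (length hs)  ≡⟨ ℕₚ.+-suc (length xs) (length hs) ⟩
          suc (length xs + length hs)  ∎)
          where open ≡-Reasoning
        -- An outside neighbour t of m would let the host absorb the pair m, t.
        concealed : ∀ {t} → m ~ t → t ∈ xs
        concealed {t} m~t with t ∈? xs
        ... | yes t∈ = t∈
        ... | no  t∉ = ⊥-elim outside-⊥
          where
          ¬am : ¬ Attached m
          ¬am = proj₂ (All.lookup body-ad (Permₚ.∈-resp-↭ perm (here refl)))
          t-body : Body t
          t-body = (λ ht → ¬am (t , ht , m~t)) , λ (h , hh , t~h) → ¬am (t , H-step hh (~-sym t~h) t∉ , m~t)
          t-deep : Deep t
          t-deep = grow lm m~t t-body
          outside-⊥ : ⊥
          outside-⊥ with below (here refl) lm
          ... | w , w∈ , lw with insert-pair q (Permₚ.All-resp-↭ (↭-sym perm′) (Allₚ.++⁺ dms′ dbs))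
                                   (Permₚ.∈-resp-↭ (↭-sym perm′) (∈-++⁺ʳ ms w∈)) lw lm (proj₂ t-deep) m~t
          ...   | cs′ , q′ , perm″ = no-merge F q′ b≡
            (↭-trans perm″ (↭-trans (swap m t ↭-refl) (prep t (↭-trans (prep m perm′) perm))))
            ((t∉ , proj₁ t-body) ∷ []) ([] ∷ [])
        -- If the path through `H` has more vertices than `h`, the cycle is longer. Otherwise `h`
        -- replaces `m`: the exposed `h` is gone, and `m` does not become exposed.
        shorter : ∀ hs → zs ++ m ∷ [] ↭ xs ++ h ∷ hs → ⊥
        shorter (_ ∷ hs) all↭ = ℕₚ.<⇒≱ (subst (length xs <_) (sym (count (_ ∷ hs) all↭))
          (ℕₚ.m<m+n (length xs) (s≤s z≤n))) (max p e us)
        shorter [] all↭ = better closing′ (trans (count [] all↭) (ℕₚ.+-identityʳ _))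
          (count-< (exposed? xs) (exposed? zs) exposed (∈-allFin h) h-exposed λ (h∉ , _) → h∉ h∈zs)
          where
          moved : ∀ {z} → z ∈ xs → z ∈ zs ⊎ z ≡ m
          moved z∈ with ∈-++⁻ zs (Permₚ.∈-resp-↭ (↭-sym all↭) (∈-++⁺ˡ z∈))
          ... | inj₁ z∈zs       = inj₁ z∈zs
          ... | inj₂ (here z≡m) = inj₂ z≡m
          h∈zs : h ∈ zs
          h∈zs with ∈-++⁻ zs (Permₚ.∈-resp-↭ (↭-sym all↭) (∈-++⁺ʳ xs (here refl)))
          ... | inj₁ h∈          = h∈
          ... | inj₂ (here refl) = contradiction m∈xs (H∉ hh)
          h-exposed : Exposed xs h
          h-exposed with H-neighbour hh
          ... | t , ht , h~t = H∉ hh , t , H∉ ht , h~t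
          outside : ∀ {z t} → z ∉ zs → t ∉ zs → z ~ t → z ∉ xs
          outside z∉ t∉ z~t z∈ with moved z∈
          ... | inj₁ z∈zs = z∉ z∈zs
          ... | inj₂ refl with moved (concealed z~t)
          ...   | inj₁ t∈zs = t∉ t∈zs
          ...   | inj₂ refl = ≁-refl z~t
          exposed : ∀ {z} → Exposed zs z → Exposed xs z
          exposed (z∉ , t , t∉ , z~t) = outside z∉ t∉ z~t , t , outside t∉ z∉ (~-sym z~t) , z~t

      deep-a : All Deep as
      deep-a = deepen arm-a (Allₚ.++⁻ˡ as body-ad)

      deep-d : All Deep ds
      deep-d = deepen arm-d (Allₚ.++⁻ʳ as body-ad)

      finish : ⊥
      finish with comparable arm-a deep-a arm-d deep-d
      ... | inj₁ below = host arm-a arm-d (inj₂ refl) ↭-refl deep-a deep-d below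
      ... | inj₂ below = host arm-d arm-a (inj₁ refl) (Permₚ.++-comm ds as) deep-d deep-a below

    no-frame : (∀ z → Dec (H z)) → ¬ Frame
    no-frame H? F@record { arm-a = nil } = no-merge F (Frame.arm-d F) (inj₂ refl) ↭-refl [] []
    no-frame H? F@record { arm-a = arm-a@(_ ∷ _) ; att-u = att-u@(x , hx , u~x) ; free-a = free-a } with H-neighbour hx | outward arm-a
    ... | y , hy , x~y | b , bs , _ , u~b , perm =
      Finish.finish F Level lu level-unique level-step complete independent (grow att-u)
      where
      off : ∀ {h} → H h → h ≁ b
      off hh e = All.lookup free-a (Permₚ.∈-resp-↭ perm (here refl)) (_ , hh , ~-sym e)
      -- u ~ y would give a paw: the triangle u, x, y and the arc neighbour `b` of `u`, which sees
      -- nothing of `H`.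
      open Layers H? (on-cycle F (here refl)) hx hy x~y u~x (λ u~y → no-paw u~x x~y u~y u~b (off hx) (off hy))

  not-extremal : ¬ Extremal
  not-extremal (_ , c , l , max , better , _ , _ , e , x∉ , y∉) =
    Component.framed c e x∉ y∉ max tc l (no-frame c e x∉ y∉ max better)

-- K₁,₃ and Z₄

module Shortcuts (G : Graph) where
  open Paths G

  -- The last case is an induced path on four vertices from `a`, the right length for the tail of
  -- `Z4`; it may stop short of `b`.
  data Shortcut (a b : V) (zs : List V) : Set where
    trivial  : a ≡ b → Shortcut a b zs
    direct  : a ~ b → Shortcut a b zs
    via     : ∀ {c} → c ∈ zs → a ~ c → c ~ b → Shortcut a b zs
    chordless : ∀ {c d e} → c ∈ zs → d ∈ zs → e ∈ zs → a ~ c → c ~ d → d ~ e →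
              a ≁ d → a ≁ e → c ≁ e → a ≢ d → a ≢ e → Shortcut a b zs

  widen : ∀ {a b zs zs′} → (∀ {z} → z ∈ zs → z ∈ zs′) → Shortcut a b zs → Shortcut a b zs′
  widen ⊆ (trivial e)      = trivial e
  widen ⊆ (direct e)    = direct e
  widen ⊆ (via c∈ e f)  = via (⊆ c∈) e f
  widen ⊆ (chordless c∈ d∈ e∈ x y z p q r s t) = chordless (⊆ c∈) (⊆ d∈) (⊆ e∈) x y z p q r s t

  -- A chord among the first four vertices shortens the path; `n` bounds its length for the
  -- recursion.
  shortcut : ∀ n {a b zs} → length zs ≤ n → Path a b zs → Unique zs → Shortcut a b zs
  shortcut _ _ end             _ = trivial refl
  shortcut _ _ (e ∷ end)       _ = direct e
  shortcut _ _ (e ∷ f ∷ end)   _ = via (there (here refl)) e f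
  shortcut (suc n) (s≤s le) (_∷_ {a} e (_∷_ {c} f (_∷_ {d} {g} h p)))
           ((a≢c ∷ a≢d ∷ a#) ∷ c# ∷ d# ∷ us)
    with a ~? d | a ~? g | c ~? g
  ...   | yes a~d | _ | _ = widen (λ { (here q) → here q ; (there q) → there (there q) })
          (shortcut n le (a~d ∷ h ∷ p) ((a≢d ∷ a#) ∷ d# ∷ us))
  ...   | no _ | yes a~g | _ = widen (λ { (here q) → here q ; (there q) → there (there (there q)) })
          (shortcut n (ℕₚ.≤-trans (ℕₚ.n≤1+n _) le) (a~g ∷ p) (a# ∷ us))
  ...   | no _ | no _ | yes c~g = widen (λ { (here q) → here q ; (there (here q)) → there (here q) ; (there (there q)) → there (there (there q)) })
          (shortcut n le (e ∷ c~g ∷ p) ((a≢c ∷ a#) ∷ All.tail c# ∷ us))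
  ...   | no a≁d | no a≁g | no c≁g =
    chordless (there (here refl)) (there (there (here refl))) (there (there (there (head∈ p)))) e f h
      a≁d a≁g c≁g a≢d (All.lookup a# (head∈ p))

module Z4Case (G : Graph) (tc : TwoConnected G) (claw-free : Free K13 G) (Z4-free : Free Z4 G) where
  open ClawThetas G claw-free
  open Shortcuts G

  no-Z4 : ∀ {t p q a b c d} → t ~ p → p ~ q → t ~ q → t ~ a → a ~ b → b ~ c → c ~ d →
          t ≁ b → t ≁ c → t ≁ d → p ≁ a → p ≁ b → p ≁ c → p ≁ d → q ≁ a → q ≁ b → q ≁ c → q ≁ d →
          a ≁ c → a ≁ d → b ≁ d → ⊥
  no-Z4 tp pq tq ta ab bc cd tb tc td pa pb pc pd qa qb qc qd ac ad bd =
    Z4-free (induced Z4 (_ ∷ _ ∷ _ ∷ _ ∷ _ ∷ _ ∷ _ ∷ [])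
      ((tp , tq , ta , tb , tc , td) , (pq , pa , pb , pc , pd) , (qa , qb , qc , qd) , (ab , ac , ad) , (bc , bd) , cd))

  module _ {xs : List V} (closing : Closing xs) {x₀ y₀ : V} (x₀~y₀ : x₀ ~ y₀)
           (x₀∉ : x₀ ∉ xs) (y₀∉ : y₀ ∉ xs) (max : NoLonger (length xs)) where
    open Bypass closing x₀~y₀ x₀∉ y₀∉ max

    Proper : Theta → Set
    Proper T = Theta.x T ≢ Theta.y T

    ∣A∣ ∣X∣ : Theta → ℕ
    ∣A∣ T = length (Theta.A T)
    ∣X∣ T = length (Theta.X T)

    -- Minimality of A, supplied by the induction in `no-proper`. A `Theta` fixes the vertex set of
    -- the cycle but not its order, so rearranged cycles compete too.
    ShorterArc : Theta → Set
    ShorterArc T = ∀ T′ → Proper T′ → ∣A∣ T′ < ∣A∣ T → ⊥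

    mirror-arc : ∀ T → ShorterArc T → ShorterArc (mirror T)
    mirror-arc T ih T′ pr lt = ih T′ pr (subst (_ <_) (Listₚ.length-reverse (Theta.A T)) lt)

    -- If w ∈ A had an outside neighbour h ≠ x, the pair (u , w) would cut off a shorter arc.
    attached-in-A : ∀ T → ShorterArc T → ∀ {w h} → w ∈ Theta.A T → H h → w ~ h → h ≡ Theta.x T
    attached-in-A T ih {w} {h} w∈ hh w~h = decidable-stable (h ≟ Theta.x T) λ h≢x → go h≢x (∈-∃++ w∈)
      where
      open Theta T
      go : h ≢ x → (∃ λ A₁ → ∃ λ A₂ → A ≡ A₁ ++ [ w ] ++ A₂) → ⊥
      go h≢x (A₁ , A₂ , refl) with H-path (H-X T (head∈ path-x)) hh
      ... | hs , p , us , hs-H with theta-at (chord p hs-H us u~x (~-sym w~h)) A₁ (A₂ ++ v ∷ D)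
             (subst (Path u d′) (cong (u ∷_) (Listₚ.++-assoc A₁ (w ∷ A₂) (v ∷ D)))
               (append (u~a ∷ path-a) a′~v (v~d ∷ path-d))) d′~u
             (↭-trans (↭-reflexive (cong (u ∷_) (sym (Listₚ.++-assoc A₁ (w ∷ A₂) (v ∷ D)))))
               (↭-trans (solve 4 (λ u a v d → (u ⊕ (a ⊕ (v ⊕ d))) ⊜ (a ⊕ (d ⊕ (u ⊕ v)))) ↭-refl [ u ] A [ v ] D) cover))
      ...   | T′ , refl , refl , refl , refl , A≡ = ih T′ (h≢x ∘ sym)
        (subst (λ zs → length zs < length (A₁ ++ w ∷ A₂)) (sym A≡)
          (subst (length A₁ <_) (sym (Listₚ.length-++ A₁)) (ℕₚ.m<m+n (length A₁) (s≤s z≤n))))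

    -- By `attached-in-A` and its mirror image the outside neighbour would equal both `x` and `y`.
    free-in-A : ∀ T → Proper T → ShorterArc T → ∀ {w h} → w ∈ Theta.A T → H h → w ≁ h
    free-in-A T pr ih w∈ hh w~h with attached-in-A T ih w∈ hh w~h
    ... | refl = pr (attached-in-A (mirror T) (mirror-arc T ih) (Permₚ.∈-resp-↭ (↭-sym (Permₚ.↭-reverse _)) w∈) hh w~h)

    differ : ∀ {a b c} → a ~ c → b ≁ c → a ≢ b
    differ e n refl = n e

    module Ends (T : Theta) (pr : Proper T) (ih : ShorterArc T) where
      open Theta T
      open Arcs T public

      hx : H x
      hx = H-X T (head∈ path-x)
      hy : H y
      hy = H-X T (last∈ path-x)

      A≁ : ∀ {w h} → w ∈ A → H h → w ≁ h
      A≁ = free-in-A T pr ih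
      d′≁ : ∀ {h} → H h → d′ ≁ h
      d′≁ = tip-apart T
      d≁ : ∀ {h} → H h → d ≁ h
      d≁ = tip-apart (mirror T)

      a∈ : a ∈ A
      a∈ = head∈ path-a
      a′∈ : a′ ∈ A
      a′∈ = last∈ path-a

      a~d₁ : a ~ d′
      a~d₁ = a~d′ T (A≁ a∈ hx) (d′≁ hx)
      a′~d : a′ ~ d
      a′~d = a~d′ (mirror T) (A≁ a′∈ hy) (d≁ hy)

      a≁v₁ : a ≁ v
      a≁v₁ = a≁v a~d₁ a′~d
      a′≁u₁ : a′ ≁ u
      a′≁u₁ = a′≁u a~d₁ a′~d
      d≁u₁ : d ≁ u
      d≁u₁ = d≁u a~d₁ a′~d
      d′≁v₁ : d′ ≁ v
      d′≁v₁ = d′≁v a~d₁ a′~d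

      u∉A : u ∉ A
      u∉A u∈ = Unique-disjoint A unique-parts u∈ (∈-++⁺ʳ D (here refl)) refl

      -- A neighbour w of u inside A allows the cycle to be rearranged so that A gets shorter:
      -- u moves next to w, or w moves next to u.
      u-in-A : ∀ {w} → w ∈ A → w ≢ a → w ≁ u
      u-in-A {w} w∈ w≢a w~u = go (interior w∈ w≢a λ { refl → a′≁u₁ w~u })
        where
        go : Interior w → ⊥
        go I with Interior.b I ~? u | Interior.c I ~? u
        ... | yes b~u | _ = ih T′ pr (ℕₚ.<-≤-trans shorter (ℕₚ.≤-reflexive (cong length (sym whole-a))))
          where
          open Interior I
          -- The initial part of A is moved behind D, across the edge from `d′` to `a`.
          T′ : Theta
          T′ = record T { path-a = w~c ∷ after ; path-d = append path-d (~-sym a~d₁) before ; u~a = ~-sym w~u ; d′~u = b~u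
            ; cover = ↭-trans (solve 4 (λ m n d r → (n ⊕ ((d ⊕ m) ⊕ r)) ⊜ ((m ⊕ n) ⊕ (d ⊕ r))) ↭-refl A₁ (w ∷ A₂) D (u ∷ v ∷ []))
                (↭-trans (↭-reflexive (cong (_++ D ++ u ∷ v ∷ []) (sym whole-a))) cover) }
          shorter : length (w ∷ A₂) < length (A₁ ++ w ∷ A₂)
          shorter = subst (length (w ∷ A₂) <_) (sym (Listₚ.length-++ A₁)) (ℕₚ.m<n+m _ (path-pos before))
        ... | no _ | yes c~u = ih T′ pr (ℕₚ.<-≤-trans shorter (ℕₚ.≤-reflexive (cong length (sym whole-a))))
          where
          open Interior I
          T′ : Theta
          T′ = record T { path-a = after ; path-d = append (append path-d (~-sym a~d₁) before) b~w end ; u~a = ~-sym c~u ; d′~u = w~u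
            ; cover = ↭-trans (solve 5 (λ m w n d r → (n ⊕ (((d ⊕ m) ⊕ w) ⊕ r)) ⊜ ((m ⊕ (w ⊕ n)) ⊕ (d ⊕ r))) ↭-refl A₁ [ w ] A₂ D (u ∷ v ∷ []))
                (↭-trans (↭-reflexive (cong (_++ D ++ u ∷ v ∷ []) (sym whole-a))) cover) }
          shorter : length A₂ < length (A₁ ++ w ∷ A₂)
          shorter = subst (length A₂ <_) (sym (Listₚ.length-++ A₁)) (ℕₚ.<-≤-trans (ℕₚ.n<1+n _) (ℕₚ.m≤n+m _ (length A₁)))
        ... | no b≁u | no c≁u = ih T′ pr (ℕₚ.<-≤-trans shorter (ℕₚ.≤-reflexive (cong length (sym whole-a))))
          where
          open Interior I
          unique-a : Unique (A₁ ++ w ∷ A₂)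
          unique-a = subst Unique whole-a (Unique-++⁻ˡ A unique-parts)
          b∈ : b ∈ A
          b∈ = subst (b ∈_) (sym whole-a) (∈-++⁺ˡ (last∈ before))
          c∈ : c ∈ A
          c∈ = subst (c ∈_) (sym whole-a) (∈-++⁺ʳ A₁ (there (head∈ after)))
          b~c : b ~ c
          b~c = decidable-stable (b ~? c) λ b≁c → no-claw w~u (~-sym b~w) w~c (λ { refl → u∉A b∈ }) (λ { refl → u∉A c∈ })
            (Unique-disjoint A₁ unique-a (last∈ before) (there (head∈ after))) (≁-sym b≁u) (≁-sym c≁u) b≁c
          w~d′ : w ~ d′
          w~d′ = adjacent-in-link u~x (~-sym d′~u) (~-sym w~u) hx (∈D⇒∈xs (last∈ path-d)) (∈A⇒∈xs w∈)
            (d′≁ hx) (A≁ w∈ hx) (A#D w∈ (last∈ path-d) ∘ sym)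
          T′ : Theta
          T′ = record T { path-a = append before b~c after ; path-d = append path-d (~-sym w~d′) end ; d′~u = w~u
            ; cover = ↭-trans (solve 5 (λ m w n d r → ((m ⊕ n) ⊕ ((d ⊕ w) ⊕ r)) ⊜ ((m ⊕ (w ⊕ n)) ⊕ (d ⊕ r))) ↭-refl A₁ [ w ] A₂ D (u ∷ v ∷ []))
                (↭-trans (↭-reflexive (cong (_++ D ++ u ∷ v ∷ []) (sym whole-a))) cover) }
          shorter : length (A₁ ++ A₂) < length (A₁ ++ w ∷ A₂)
          shorter = ℕₚ.≤-reflexive (sym (Permₚ.↭-length (Permₚ.shift w A₁ A₂)))

    unsnoc : ∀ {a b c zs} → a ~ b → Path b c zs → ∃ λ m → ∃ λ ys → Path a m ys × m ~ c × a ∷ zs ≡ ys ++ [ c ]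
    unsnoc e end     = _ , _ , end , e , refl
    unsnoc {a} e (f ∷ p) with unsnoc f p
    ... | m , ys , q , g , eq = m , _ , e ∷ q , g , cong (a ∷_) eq

    uncons : ∀ {a b zs} → Path a b zs → (a ≡ b × zs ≡ [ a ]) ⊎ ∃ λ c → ∃ λ cs → a ~ c × Path c b cs × zs ≡ a ∷ cs
    uncons end     = inj₁ (refl , refl)
    uncons (e ∷ p) = inj₂ (_ , _ , e , p , refl)

    module Inner (T : Theta) (pr : Proper T) (ih : ShorterArc T) where
      open Theta T
      open Ends T pr ih
      module M = Ends (mirror T) (pr ∘ sym) (mirror-arc T ih)

      v-in-A : ∀ {w} → w ∈ A → w ≢ a′ → w ≁ v
      v-in-A w∈ = M.u-in-A (Permₚ.∈-resp-↭ (↭-sym (Permₚ.↭-reverse A)) w∈)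

      ∈A-≢ : ∀ {w z} → w ∈ A → z ∈ D ++ u ∷ v ∷ [] → w ≢ z
      ∈A-≢ = Unique-disjoint A unique-parts

      ∈D-≢ : ∀ {w z} → w ∈ D → z ∈ u ∷ v ∷ [] → w ≢ z
      ∈D-≢ = Unique-disjoint D (Unique-++⁻ʳ A unique-parts)

      u≢ : ∀ {w} → w ∈ A → u ≢ w
      u≢ w∈ = ∈A-≢ w∈ (∈-++⁺ʳ D (here refl)) ∘ sym

      v-part : v ∈ D ++ u ∷ v ∷ []
      v-part = ∈-++⁺ʳ D (there (here refl))

      setup : ∀ {hs ys} → All H hs → Unique hs → 0 < length hs → ys ↭ A ++ D ++ u ∷ v ∷ [] →
              Unique (hs ++ ys) × length xs < length (hs ++ ys)
      setup {hs} hH us pos perm = exchange hH us pos (Permₚ.++⁺ˡ hs (↭-trans perm cover))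

      record Second : Set where
        field
          {m}    : V
          {M}    : List V
          a~m    : a ~ m
          onward : Path m a′ M
          shape  : A ≡ a ∷ M
        m∈ : m ∈ A
        m∈ = subst (m ∈_) (sym shape) (there (head∈ onward))
        m≢a : m ≢ a
        m≢a = ~⇒≢ a~m ∘ sym

      second : Second
      second with uncons path-a
      ... | inj₁ (a≡a′ , _)            = contradiction a′~d (subst (_≁ d) a≡a′ a≁d)
      ... | inj₂ (_ , _ , e , p , eq) = record { a~m = e ; onward = p ; shape = eq }

      u~v⇒x~v : u ~ v → x ~ v
      u~v⇒x~v u~v = decidable-stable (x ~? v) λ x≁v → no-claw u~x u~v u~a (H-≢ hx v∈xs) (H-≢ hx (∈A⇒∈xs a∈))
        (∈A-≢ a∈ v-part ∘ sym) x≁v (≁-sym (A≁ a∈ hx)) (≁-sym a≁v₁)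

      module WithSecond (S : Second) where
        open Second S
        private uniq = setup outside unique-x (path-pos path-x) (↭-reflexive (cong (_++ D ++ u ∷ v ∷ []) (sym shape)))
        open Exchange max (seg path-x ∷ single a ∷ seg onward ∷ seg path-d ∷ single u ∷ single v ∷ []) (proj₁ uniq)

        m≁d : m ≁ d
        m≁d e = full-tour (proj₂ uniq) (fw 5) (bw 2 ∷ fw 3 ∷ fw 1 ∷ fw 4 ∷ fw 0 ∷ [])
          (~-sym a′~v , e , ~-sym a~d₁ , ~-sym u~a , u~x , y~v)

        m≁u : m ≁ u
        m≁u = u-in-A m∈ m≢a

      -- The arc D leaves the neighbourhood of v at the edge r g.
      record Run : Set where
        field
          {r g}  : V
          {R G′} : List V
          path-r : Path d r R
          path-g : Path g d′ G′
          r~v    : r ~ v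
          r~g    : r ~ g
          g≁v    : g ≁ v
          shape  : D ≡ R ++ G′
          prior  : r ≡ d ⊎ ∃ λ q → ∃ λ Q → Path d q Q × q ~ r × q ~ v × R ≡ Q ++ [ r ]

      -- It exists since `d` is adjacent to `v` and `d′` is not. If a ~ a′, the arc A gives the tail
      -- of `Z4` two vertices, and `r`, `g` are the other two; g ≁ v is needed for a′ ≁ g, by a claw
      -- at `a′`.
      run : Run
      run with uncons path-d
      ... | inj₁ (d≡d′ , _)            = contradiction (~-sym v~d) (subst (_≁ v) (sym d≡d′) d′≁v₁)
      ... | inj₂ (_ , _ , e , p , eq) = extend end (~-sym v~d) (inj₁ refl) e p eq
        where
        extend : ∀ {r g R G′} → Path d r R → r ~ v → (r ≡ d ⊎ ∃ λ q → ∃ λ Q → Path d q Q × q ~ r × q ~ v × R ≡ Q ++ [ r ]) →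
                 r ~ g → Path g d′ G′ → D ≡ R ++ G′ → Run
        extend {g = g} pr r~v prior r~g pg eq with g ~? v
        ... | no g≁v = record { path-r = pr ; path-g = pg ; r~v = r~v ; r~g = r~g ; g≁v = g≁v ; shape = eq ; prior = prior }
        extend pr r~v prior r~g end eq | yes g~v = contradiction g~v d′≁v₁
        extend {r} {g} {R} {_ ∷ G′} pr r~v prior r~g (f ∷ pg) eq | yes g~v =
          extend (append pr r~g end) g~v (inj₂ (r , R , pr , r~g , r~v , refl)) f pg
            (trans eq (sym (Listₚ.++-assoc R [ g ] G′)))

      module WithRun (S : Run) where
        open Run S

        parts : A ++ R ++ G′ ++ u ∷ v ∷ [] ↭ A ++ D ++ u ∷ v ∷ []
        parts = ↭-reflexive (cong (A ++_) (trans (sym (Listₚ.++-assoc R G′ _)) (cong (_++ u ∷ v ∷ []) (sym shape))))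

        r∈ : r ∈ D
        r∈ = subst (r ∈_) (sym shape) (∈-++⁺ˡ (last∈ path-r))
        g∈ : g ∈ D
        g∈ = subst (g ∈_) (sym shape) (∈-++⁺ʳ R (head∈ path-g))

        g≁ : ∀ {h} → H h → g ≁ h
        g≁ hh e with H-path hh hy
        ... | hs , p , us , hs-H with setup hs-H us (path-pos p) parts
        ...   | us′ , lt = full-tour lt (fw 0) (fw 5 ∷ bw 2 ∷ bw 1 ∷ fw 4 ∷ bw 3 ∷ [])
          (y~v , ~-sym r~v , ~-sym a′~d , ~-sym u~a , ~-sym d′~u , e)
          where open Exchange max (seg p ∷ seg path-a ∷ seg path-r ∷ seg path-g ∷ single u ∷ single v ∷ []) us′

        a≁g : a ≁ g
        a≁g e = full-tour (proj₂ uniq) (fw 5) (bw 2 ∷ bw 1 ∷ fw 3 ∷ fw 4 ∷ fw 0 ∷ [])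
          (~-sym r~v , ~-sym a′~d , e , d′~u , u~x , y~v)
          where
          uniq = setup outside unique-x (path-pos path-x) parts
          open Exchange max (seg path-x ∷ seg path-a ∷ seg path-r ∷ seg path-g ∷ single u ∷ single v ∷ []) (proj₁ uniq)

        module _ {q Q} (pq : Path d q Q) (q~r : q ~ r) (q~v : q ~ v) (R≡ : R ≡ Q ++ [ r ]) where

          parts′ : A ++ Q ++ r ∷ G′ ++ u ∷ v ∷ [] ↭ A ++ D ++ u ∷ v ∷ []
          parts′ = ↭-trans (↭-reflexive (cong (A ++_) (trans (sym (Listₚ.++-assoc Q [ r ] _)) (cong (_++ G′ ++ u ∷ v ∷ []) (sym R≡))))) parts

          -- Through the predecessor `q`, also a neighbour of `v`, a tour can enter D before `r` and
          -- come to `r` later from `a`.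
          q⇒a≁r : a ≁ r
          q⇒a≁r e = full-tour (proj₂ uniq) (fw 6) (bw 2 ∷ bw 1 ∷ fw 3 ∷ fw 4 ∷ fw 5 ∷ fw 0 ∷ [])
            (~-sym q~v , ~-sym a′~d , e , r~g , d′~u , u~x , y~v)
            where
            uniq = setup outside unique-x (path-pos path-x) parts′
            open Exchange max (seg path-x ∷ seg path-a ∷ seg pq ∷ single r ∷ seg path-g ∷ single u ∷ single v ∷ []) (proj₁ uniq)

          q⇒r≁ : ∀ {h} → H h → r ≁ h
          q⇒r≁ hh e with H-path hh hy
          ... | hs , p , us , hs-H with setup hs-H us (path-pos p) parts′
          ...   | us′ , lt = full-tour lt (fw 0) (fw 6 ∷ bw 2 ∷ bw 1 ∷ fw 5 ∷ bw 4 ∷ fw 3 ∷ [])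
            (y~v , ~-sym q~v , ~-sym a′~d , ~-sym u~a , ~-sym d′~u , ~-sym r~g , e)
            where open Exchange max (seg p ∷ seg path-a ∷ seg pq ∷ single r ∷ seg path-g ∷ single u ∷ single v ∷ []) us′

        a≁r : a ≁ r
        a≁r with prior
        ... | inj₁ r≡d = subst (a ≁_) (sym r≡d) a≁d
        ... | inj₂ (_ , _ , pq , q~r , q~v , R≡) = q⇒a≁r pq q~r q~v R≡

        r≁ : ∀ {h} → H h → r ≁ h
        r≁ with prior
        ... | inj₁ r≡d = subst (λ z → ∀ {h} → H h → z ≁ h) (sym r≡d) d≁
        ... | inj₂ (_ , _ , pq , q~r , q~v , R≡) = q⇒r≁ pq q~r q~v R≡

        u≁D : ∀ {z} → z ∈ D → (∀ {h} → H h → z ≁ h) → a ≁ z → u ≁ z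
        u≁D z∈ z≁ a≁z u~z = a≁z (~-sym (adjacent-in-link u~x u~a u~z hx (∈A⇒∈xs a∈) (∈D⇒∈xs z∈) (A≁ a∈ hx) (z≁ hx) (A#D a∈ z∈)))

        a′~r : a′ ~ r
        a′~r = ~-sym (adjacent-in-link (~-sym y~v) (~-sym a′~v) (~-sym r~v) hy (∈A⇒∈xs a′∈) (∈D⇒∈xs r∈) (A≁ a′∈ hy) (r≁ hy) (A#D a′∈ r∈))

        a′≁g : a ~ a′ → a′ ≁ g
        a′≁g a~a′ e = no-claw a′~v (~-sym a~a′) e (∈A-≢ a∈ v-part ∘ sym) (∈D-≢ g∈ (there (here refl)) ∘ sym) (A#D a∈ g∈)
          (≁-sym a≁v₁) (≁-sym g≁v) a≁g

        run-⊥ : x ~ y → u ~ y → a ~ a′ → ⊥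
        run-⊥ x~y u~y a~a′ = no-Z4 u~x x~y u~y u~a a~a′ a′~r r~g
          (≁-sym a′≁u₁) (u≁D r∈ r≁ a≁r) (u≁D g∈ g≁ a≁g)
          (≁-sym (A≁ a∈ hx)) (≁-sym (A≁ a′∈ hx)) (≁-sym (r≁ hx)) (≁-sym (g≁ hx))
          (≁-sym (A≁ a∈ hy)) (≁-sym (A≁ a′∈ hy)) (≁-sym (r≁ hy)) (≁-sym (g≁ hy))
          a≁r a≁g (a′≁g a~a′)

      module Via {c : V} (c∈ : c ∈ A) (a~c : a ~ c) (c~a′ : c ~ a′) (a≁a′ : a ≁ a′) where
        open Second second
        open WithSecond second

        c≢a : c ≢ a
        c≢a refl = ≁-refl a~c
        c≢a′ : c ≢ a′
        c≢a′ refl = ≁-refl c~a′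
        c≁u : c ≁ u
        c≁u = u-in-A c∈ c≢a
        c≁v : c ≁ v
        c≁v = v-in-A c∈ c≢a′

        -- The triangle u, x, y with tail a, c, a′, d serves unless c ~ d. Then the triangle y, x, u
        -- with tail v, d, c, m serves if x ≁ v, and the triangle v, x, y with tail a′, c, a, d′ if
        -- x ~ v.
        via-⊥ : x ~ y → u ~ y → ⊥
        via-⊥ x~y u~y = case-⊥ {c ~ d} far λ c≁d →
          no-Z4 u~x x~y u~y u~a a~c c~a′ a′~d
            (≁-sym c≁u) (≁-sym a′≁u₁) (≁-sym d≁u₁)
            (≁-sym (A≁ a∈ hx)) (≁-sym (A≁ c∈ hx)) (≁-sym (A≁ a′∈ hx)) (≁-sym (d≁ hx))
            (≁-sym (A≁ a∈ hy)) (≁-sym (A≁ c∈ hy)) (≁-sym (A≁ a′∈ hy)) (≁-sym (d≁ hy))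
            a≁a′ a≁d c≁d
          where
          far : c ~ d → ⊥
          far c~d = case-⊥ {x ~ v} together λ x≁v →
            no-Z4 (~-sym x~y) (~-sym u~x) (~-sym u~y) y~v v~d (~-sym c~d) (~-sym m~c)
              (≁-sym (d≁ hy)) (≁-sym (A≁ c∈ hy)) (≁-sym (A≁ m∈ hy))
              x≁v (≁-sym (d≁ hx)) (≁-sym (A≁ c∈ hx)) (≁-sym (A≁ m∈ hx))
              (x≁v ∘ u~v⇒x~v) (≁-sym d≁u₁) (≁-sym c≁u) (≁-sym m≁u)
              (≁-sym c≁v) (≁-sym (v-in-A m∈ λ m≡a′ → a≁a′ (subst (a ~_) m≡a′ a~m))) (≁-sym m≁d)
            where
            m~c : m ~ c
            m~c = decidable-stable (m ~? c) λ m≁c → no-claw (~-sym u~a) a~m a~c (u≢ m∈) (u≢ c∈) (differ c~d m≁d ∘ sym)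
              (≁-sym m≁u) (≁-sym c≁u) m≁c
            together : x ~ v → ⊥
            together x~v = case-⊥ {c ~ d′} (no-crossing T c∈ (~-sym a~c) c~d) λ c≁d′ →
              no-Z4 (~-sym x~v) x~y (~-sym y~v) (~-sym a′~v) (~-sym c~a′) (~-sym a~c) a~d₁
                (≁-sym c≁v) (≁-sym a≁v₁) (≁-sym d′≁v₁)
                (≁-sym (A≁ a′∈ hx)) (≁-sym (A≁ c∈ hx)) (≁-sym (A≁ a∈ hx)) (≁-sym (d′≁ hx))
                (≁-sym (A≁ a′∈ hy)) (≁-sym (A≁ c∈ hy)) (≁-sym (A≁ a∈ hy)) (≁-sym (d′≁ hy))
                (≁-sym a≁a′) a′≁d′ c≁d′

      -- The triangle is u, x, y and the tail starts at `a`; `shortcut` tells how much of it A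
      -- supplies.
      triangle-⊥ : x ~ y → u ~ y → ⊥
      triangle-⊥ x~y u~y with a ~? a′ | shortcut _ ℕₚ.≤-refl path-a (Unique-++⁻ˡ A unique-parts)
      ... | yes a~a′ | _             = WithRun.run-⊥ run x~y u~y a~a′
      ... | no a≁a′  | trivial a≡a′  = subst (_≁ d) a≡a′ a≁d a′~d
      ... | no a≁a′  | direct a~a′   = a≁a′ a~a′
      ... | no a≁a′  | via c∈ e f    = Via.via-⊥ c∈ e f a≁a′ x~y u~y
      ... | no _     | chordless {c} {p} {q} c∈ p∈ q∈ a~c c~p p~q a≁p a≁q c≁q a≢p a≢q =
        no-Z4 u~x x~y u~y u~a a~c c~p p~q (u≁ c∈ λ { refl → ≁-refl a~c }) (u≁ p∈ (a≢p ∘ sym)) (u≁ q∈ (a≢q ∘ sym))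
          (≁-sym (A≁ a∈ hx)) (≁-sym (A≁ c∈ hx)) (≁-sym (A≁ p∈ hx)) (≁-sym (A≁ q∈ hx))
          (≁-sym (A≁ a∈ hy)) (≁-sym (A≁ c∈ hy)) (≁-sym (A≁ p∈ hy)) (≁-sym (A≁ q∈ hy))
          a≁p a≁q c≁q
        where
        u≁ : ∀ {w} → w ∈ A → w ≢ a → u ≁ w
        u≁ w∈ w≢a = ≁-sym (u-in-A w∈ w≢a)

      record Middle : Set where
        field
          {c q}  : V
          {C}    : List V
          a~c    : a ~ c
          inner  : Path c q C
          q~a′   : q ~ a′
          shape  : A ≡ a ∷ C ++ [ a′ ]
          c≢q    : c ≢ q
        unique-A : Unique ((a ∷ C) ++ [ a′ ])
        unique-A = subst Unique shape (Unique-++⁻ˡ A unique-parts)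
        c∈ : c ∈ A
        c∈ = subst (c ∈_) (sym shape) (there (∈-++⁺ˡ (head∈ inner)))
        q∈ : q ∈ A
        q∈ = subst (q ∈_) (sym shape) (there (∈-++⁺ˡ (last∈ inner)))
        c≢a : c ≢ a
        c≢a = ~⇒≢ a~c ∘ sym
        q≢a′ : q ≢ a′
        q≢a′ = ~⇒≢ q~a′
        c≢a′ : c ≢ a′
        c≢a′ = Unique-disjoint (a ∷ C) unique-A (there (head∈ inner)) (here refl)
        q≢a : q ≢ a
        q≢a q≡a = Uniqueₚ.Unique[x∷xs]⇒x∉xs unique-A (∈-++⁺ˡ (subst (_∈ C) q≡a (last∈ inner)))

      -- Skipping the interior of A gains X, so that interior has at least as many vertices as X.
      middle : Middle
      middle with second
      ... | record { a~m = e ; onward = p ; shape = A≡ } with unsnoc e p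
      ...   | q , ys , path-q , q~a′ , eq with uncons path-q
      ...     | inj₁ (a≡q , ys≡) = ⊥-elim (full-tour (proj₂ uniq) (fw 4) (fw 0 ∷ fw 5 ∷ fw 2 ∷ fw 3 ∷ fw 1 ∷ [])
        (u~x , y~v , ~-sym a′~v , a′~d , ~-sym a~d₁ , ~-sym u~a))
        where
        parts : a ∷ a′ ∷ D ++ u ∷ v ∷ [] ↭ A ++ D ++ u ∷ v ∷ []
        parts = ↭-reflexive (cong (_++ D ++ u ∷ v ∷ []) (sym (trans A≡ (trans eq (cong (_++ [ a′ ]) ys≡)))))
        uniq = setup outside unique-x (path-pos path-x) parts
        open Exchange max (seg path-x ∷ single a ∷ single a′ ∷ seg path-d ∷ single u ∷ single v ∷ []) (proj₁ uniq)
      ...     | inj₂ (c , C , a~c , inner , ys≡) =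
        record { a~c = a~c ; inner = inner ; q~a′ = q~a′ ; shape = A≡′ ; c≢q = c≢q }
        where
        A≡′ : A ≡ a ∷ C ++ [ a′ ]
        A≡′ = trans A≡ (trans eq (cong (_++ [ a′ ]) ys≡))
        parts : a ∷ C ++ a′ ∷ D ++ u ∷ v ∷ [] ↭ A ++ D ++ u ∷ v ∷ []
        parts = ↭-reflexive (trans (cong (a ∷_) (sym (Listₚ.++-assoc C [ a′ ] _))) (cong (_++ D ++ u ∷ v ∷ []) (sym A≡′)))
        total = with-outside (All.map H∉ outside) unique-x (Permₚ.++⁺ˡ X (↭-trans parts cover))
        open Exchange max (seg path-x ∷ single a ∷ seg inner ∷ single a′ ∷ seg path-d ∷ single u ∷ single v ∷ []) (proj₁ total)
        ∣X∣≤∣C∣ : length X ≤ length C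
        ∣X∣≤∣C∣ = ℕₚ.+-cancelʳ-≤ (length xs) (length X) (length C) (begin
          length X + length xs         ≡⟨ proj₂ total ⟨
          length (X ++ a ∷ C ++ a′ ∷ D ++ u ∷ v ∷ [])
            ≤⟨ tour (fw 5) (fw 0 ∷ fw 6 ∷ fw 3 ∷ fw 4 ∷ fw 1 ∷ []) (# 2 ∷ [])
                 (u~x , y~v , ~-sym a′~v , a′~d , ~-sym a~d₁ , ~-sym u~a) ⟩
          length xs + length (C ++ []) ≡⟨ cong (λ zs → length xs + length zs) (Listₚ.++-identityʳ C) ⟩
          length xs + length C         ≡⟨ ℕₚ.+-comm (length xs) (length C) ⟩
          length C + length xs         ∎)
          where open ℕₚ.≤-Reasoning
        unique-C : Unique C
        unique-C = Unique-++⁻ˡ C (Unique-++⁻ʳ (X ++ [ a ]) (subst Unique (sym (Listₚ.++-assoc X [ a ] _)) (proj₁ total)))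
        c≢q : c ≢ q
        c≢q c≡q with uncons path-x | uncons inner
        ... | inj₁ (x≡y , _) | _ = pr x≡y
        ... | inj₂ (_ , _ , _ , p , X≡) | inj₁ (_ , C≡) = ℕₚ.<⇒≱ (path-pos p)
          (ℕₚ.≤-pred (ℕₚ.≤-trans (ℕₚ.≤-reflexive (cong length (sym X≡))) (ℕₚ.≤-trans ∣X∣≤∣C∣ (ℕₚ.≤-reflexive (cong length C≡)))))
        ... | inj₂ _ | inj₂ (_ , _ , _ , p , C≡) =
          Uniqueₚ.Unique[x∷xs]⇒x∉xs (subst Unique C≡ unique-C) (subst (_∈ _) (sym c≡q) (last∈ p))

      -- Here u, x, y, v is an induced path and becomes the tail at the triangle a, c, q. The edge a
      -- a′ holds, as otherwise u, a, d′ with tail x, y, v, a′ is a `Z4`; claws at `a′` and at `a`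
      -- then give a ~ q and c ~ q.
      induced-⊥ : x ~ y → u ≁ y → x ≁ v → ⊥
      induced-⊥ x~y u≁y x≁v = no-Z4 a~c c~q a~q (~-sym u~a) u~x x~y y~v
        (A≁ a∈ hx) (A≁ a∈ hy) a≁v₁
        (u-in-A c∈ c≢a) (A≁ c∈ hx) (A≁ c∈ hy) (v-in-A c∈ c≢a′)
        (u-in-A q∈ q≢a) (A≁ q∈ hx) (A≁ q∈ hy) (v-in-A q∈ q≢a′)
        u≁y u≁v x≁v
        where
        open Middle middle
        u≁v : u ≁ v
        u≁v = x≁v ∘ u~v⇒x~v
        a~a′ : a ~ a′
        a~a′ = decidable-stable (a ~? a′) λ a≁a′ → no-Z4 u~a a~d₁ (~-sym d′~u) u~x x~y y~v (~-sym a′~v)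
          u≁y u≁v (≁-sym a′≁u₁)
          (A≁ a∈ hx) (A≁ a∈ hy) a≁v₁ a≁a′
          (d′≁ hx) (d′≁ hy) d′≁v₁ (≁-sym a′≁d′)
          x≁v (≁-sym (A≁ a′∈ hx)) (≁-sym (A≁ a′∈ hy))
        a~q : a ~ q
        a~q = decidable-stable (a ~? q) λ a≁q → no-claw a′~v (~-sym a~a′) (~-sym q~a′)
          (∈A-≢ a∈ v-part ∘ sym) (∈A-≢ q∈ v-part ∘ sym) (q≢a ∘ sym) (≁-sym a≁v₁) (≁-sym (v-in-A q∈ q≢a′)) a≁q
        c~q : c ~ q
        c~q = decidable-stable (c ~? q) λ c≁q → no-claw (~-sym u~a) a~c a~q (u≢ c∈) (u≢ q∈) c≢q
          (≁-sym (u-in-A c∈ c≢a)) (≁-sym (u-in-A q∈ q≢a)) c≁q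

      -- Minimality of the chord for fixed `u` and `v`: none with distinct ends has fewer vertices
      -- than `zs`.
      Shortenable : List V → Set
      Shortenable zs = ∀ {p q ys} → Path p q ys → All H ys → Unique ys → length ys < length zs → p ≢ q → u ~ p → q ~ v → ⊥

      u-corner : ∀ {p q} → H p → H q → p ≢ q → p ≁ q → u ~ p → u ≁ q
      u-corner hp hq p≢q p≁q u~p u~q = no-claw u~p u~q u~a p≢q (H-≢ hp (∈A⇒∈xs a∈)) (H-≢ hq (∈A⇒∈xs a∈))
        p≁q (≁-sym (A≁ a∈ hp)) (≁-sym (A≁ a∈ hq))

      -- The triangle u, a, d′ has its tail along the chord; a chord with three vertices is
      -- completed by `v`.
      long-⊥ : ∀ {p q zs} → Path p q zs → All H zs → Unique zs → p ≢ q → p ≁ q → u ~ p → q ~ v → Shortenable zs → ⊥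
      long-⊥ end _ _ p≢q _ _ _ _ = p≢q refl
      long-⊥ (e ∷ end) _ _ _ p≁q _ _ _ = p≁q e
      long-⊥ {p} {q} (_∷_ {b = s} e (f ∷ end)) (hp ∷ hs ∷ hq ∷ []) ((p≢s ∷ _) ∷ (s≢q ∷ []) ∷ us) p≢q p≁q u~p q~v sub =
        no-Z4 u~a a~d₁ (~-sym d′~u) u~p e f q~v
          (λ u~s → sub (f ∷ end) (hs ∷ hq ∷ []) ((s≢q ∷ []) ∷ us) ℕₚ.≤-refl s≢q u~s q~v)
          (u-corner hp hq p≢q p≁q u~p)
          (λ u~v → no-claw u~p u~v u~a (H-≢ hp v∈xs) (H-≢ hp (∈A⇒∈xs a∈)) (∈A-≢ a∈ v-part ∘ sym) p≁v (≁-sym (A≁ a∈ hp)) (≁-sym a≁v₁))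
          (A≁ a∈ hp) (A≁ a∈ hs) (A≁ a∈ hq) a≁v₁
          (d′≁ hp) (d′≁ hs) (d′≁ hq) d′≁v₁
          p≁q p≁v
          (λ s~v → sub (e ∷ end) (hp ∷ hs ∷ []) ((p≢s ∷ []) ∷ [] ∷ []) ℕₚ.≤-refl p≢s u~p s~v)
        where
        p≁v : p ≁ v
        p≁v p~v = no-claw (~-sym p~v) (~-sym q~v) (~-sym a′~v) p≢q (H-≢ hp (∈A⇒∈xs a′∈)) (H-≢ hq (∈A⇒∈xs a′∈))
          p≁q (≁-sym (A≁ a′∈ hp)) (≁-sym (A≁ a′∈ hq))
      long-⊥ {p} {q} (_∷_ {b = r} e (_∷_ {b = s} f (_∷_ {b = t} g z))) (hp ∷ hr ∷ hs ∷ hz)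
             ((p≢r ∷ p≢s ∷ p#) ∷ (r≢s ∷ r#) ∷ s# ∷ us) p≢q p≁q u~p q~v sub =
        no-Z4 u~a a~d₁ (~-sym d′~u) u~p e f g
          (λ u~r → sub (f ∷ g ∷ z) (hr ∷ hs ∷ hz) ((r≢s ∷ r#) ∷ s# ∷ us) ℕₚ.≤-refl (All.lookup r# (last∈ z)) u~r q~v)
          (λ u~s → sub (g ∷ z) (hs ∷ hz) (s# ∷ us) (ℕₚ.n≤1+n _) (All.lookup s# (last∈ z)) u~s q~v)
          u≁t
          (A≁ a∈ hp) (A≁ a∈ hr) (A≁ a∈ hs) (A≁ a∈ ht)
          (d′≁ hp) (d′≁ hr) (d′≁ hs) (d′≁ ht)
          (λ p~s → sub (p~s ∷ g ∷ z) (hp ∷ hs ∷ hz) ((p≢s ∷ p#) ∷ s# ∷ us) ℕₚ.≤-refl p≢q u~p q~v)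
          (λ p~t → sub (p~t ∷ z) (hp ∷ hz) (p# ∷ us) (ℕₚ.n≤1+n _) p≢q u~p q~v)
          (λ r~t → sub (e ∷ r~t ∷ z) (hp ∷ hr ∷ hz) ((p≢r ∷ p#) ∷ r# ∷ us) ℕₚ.≤-refl p≢q u~p q~v)
        where
        ht : H t
        ht = All.lookup hz (head∈ z)
        u≁t : u ≁ t
        u≁t u~t with uncons z
        ... | inj₁ (refl , _) = u-corner hp ht p≢q p≁q u~p u~t
        ... | inj₂ (_ , _ , _ , z′ , refl) = sub z hz us (ℕₚ.m≤n+m _ 2)
          (λ t≡q → Uniqueₚ.Unique[x∷xs]⇒x∉xs us (subst (_∈ _) (sym t≡q) (last∈ z′))) u~t q~v

    adjacent-⊥ : ∀ T → Proper T → ShorterArc T → Theta.x T ~ Theta.y T → ⊥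
    adjacent-⊥ T pr ih x~y with u ~? y | x ~? v
      where open Theta T
    ... | yes u~y | _       = Inner.triangle-⊥ T pr ih x~y u~y
    ... | no _    | yes x~v = Inner.triangle-⊥ (mirror T) (pr ∘ sym) (mirror-arc T ih) (~-sym x~y) (~-sym x~v)
    ... | no u≁y  | no x≁v  = Inner.induced-⊥ T pr ih x~y u≁y x≁v

    -- Lexicographic induction on the lengths of A and X.
    no-proper : ∀ T → Proper T → ∀ {m} → ∣A∣ T ≡ m → Acc _<_ m → ⊥
    no-proper T pr refl (acc shorter-A) = go T pr refl (<-wellFounded _)
      where
      ih : ∀ T′ → ∣A∣ T′ ≡ ∣A∣ T → ShorterArc T′
      ih T′ eq T″ pr lt = no-proper T″ pr refl (shorter-A (subst (_ <_) eq lt))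
      go : ∀ T′ → Proper T′ → ∣A∣ T′ ≡ ∣A∣ T → Acc _<_ (∣X∣ T′) → ⊥
      go T′ pr eq (acc shorter-X) = Inner.long-⊥ T′ pr (ih T′ eq) path-x outside unique-x pr
        (adjacent-⊥ T′ pr (ih T′ eq)) u~x y~v
        λ p hys us lt p≢q u~p q~v → go
          (record T′ { path-x = p ; u~x = u~p ; y~v = q~v ; outside = hys ; unique-x = us }) p≢q eq (shorter-X lt)
        where open Theta T′

    no-chord : ∀ {u v x y} → u ∈ xs → v ∈ xs → u ≢ v → H x → H y → x ≢ y → u ~ x → v ~ y → ⊥
    no-chord u∈ v∈ u≢v hx hy x≢y u~x v~y with H-path hx hy
    ... | hs , p , us , hs-H with theta u∈ v∈ u≢v (chord p hs-H us u~x (~-sym v~y))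
    ...   | T , refl , refl , refl , refl = no-proper T x≢y refl (<-wellFounded _)

    -- A chord with distinct ends exists: a walk avoiding `x` leads from a neighbour of `x` in `H`
    -- to the cycle. If it meets the cycle at `u`, a second attached vertex `v` is joined to
    -- whichever of `x` and `y` differs from its own neighbour `h`.
    contradictory : 3 ≤ length xs → ⊥
    contradictory l with another l x₀
    ... | c , c∈ , _ with attached-avoiding tc l c∈
    ...   | u , u∈ , _ , x , hx , u~x with H-neighbour hx
    ...     | t , ht , x~t with exit (proj₂ (proj₂ tc) x t u (~⇒≢ x~t ∘ sym) (H-≢ hx u∈ ∘ sym)) ht u∈
    ...       | y , w , hy , y≢x , w∈ , _ , y~w with w ≟ u
    ...         | no w≢u = no-chord u∈ w∈ (w≢u ∘ sym) hx hy (y≢x ∘ sym) u~x (~-sym y~w)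
    ...         | yes refl with attached-avoiding tc l u∈
    ...           | v , v∈ , v≢u , h , hh , v~h with h ≟ x
    ...             | no h≢x   = no-chord u∈ v∈ (v≢u ∘ sym) hx hh (h≢x ∘ sym) u~x v~h
    ...             | yes refl = no-chord u∈ v∈ (v≢u ∘ sym) hy hx y≢x (~-sym y~w) v~h

  not-extremal : ¬ Extremal
  not-extremal (_ , c , l , max , _ , _ , _ , e , x∉ , y∉) = contradictory c e x∉ y∉ max l

theorem2 : (F : Family) (G : Graph) → TwoConnected G → PairFree (pair F) G → HasDominatingCycle G
theorem2 claw-Z4   G tc (f₁ , f₂) = Cycles.by-extremality G tc (Z4Case.not-extremal G tc f₁ f₂)
theorem2 claw-B12  G tc (f₁ , f₂) = Cycles.by-extremality G tc (BullCase.not-extremal G tc f₁ f₂)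
theorem2 claw-N111 G tc (f₁ , f₂) = Cycles.by-extremality G tc (NetCase.not-extremal G tc f₁ f₂)
theorem2 P4-W      G tc (f₁ , f₂) = Cycles.by-extremality G tc (CographCase.not-extremal G tc f₁ f₂)
theorem2 K13ss-Z1  G tc (f₁ , f₂) = Cycles.by-extremality G tc (PawCase.not-extremal G tc f₁ f₂)
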